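{- Let $k = p_1p_2\cdots p_t \geq 6$ be even, where $p_1,\dots,p_t$ are primes, not necessarily distinct. Let $1 \leq i < t-1$, and suppose that at least one of $p_1,\dots,p_i$ equals $2$ and that $p_{i+1},\dots,p_t$ are odd primes. If $u \equiv 1 \pmod{p_1p_2\cdots p_i}$ and $g \equiv 0 \pmod{2p_{i+1}p_{i+2}\cdots p_t}$, then there exists a $k$-ARCS of $(K_u \times K_g)(2)$.
   Context: $u,g$ are positive integers. For graphs $G,H$, the tensor product $G \times H$ has vertex set $V(G)\times V(H)$, with $(g_1,h_1)$ adjacent to $(g_2,h_2)$ iff $g_1g_2 \in E(G)$ and $h_1h_2 \in E(H)$. For a graph $G$ and positive integer $\lambda$, $G(\lambda)$ is the multigraph obtained by replacing each edge of $G$ by $\lambda$ parallel edges. $K_n$ is the complete graph on $n$ vertices. $(K_u \times K_g)(\lambda)$ is regarded as a $u$-partite multigraph with partite sets $V_i = \{i\}\times V(K_g)$. A partial $C_k$-factor of $(K_u \times K_g)(\lambda)$ is a subgraph which, for some $i$, is a spanning subgraph of $(K_u \times K_g)(\lambda)\setminus V_i$ all of whose components are cycles of length $k$. A $k$-ARCS of $(K_u \times K_g)(\lambda)$ is a partition of its edge multiset into partial $C_k$-factors. -}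

module Defs where

open import Data.Nat using (ℕ; zero; suc; _+_; _%_)
open import Data.Nat.DivMod using (m%n<n)
open import Data.Fin using (Fin; zero; suc; toℕ; fromℕ<; _≟_)
open import Data.Product using (_×_; _,_; proj₁; proj₂; ∃; ∃-syntax)
open import Data.Sum using (_⊎_)
open import Relation.Binary.PropositionalEquality using (_≡_; _≢_)
open import Relation.Nullary using (Dec; yes; no)
open import Relation.Nullary.Decidable using (_×-dec_; _⊎-dec_)
open import Function.Definitions using (Injective)

-- Vertices of K_u × K_g : pairs (a , x) with a ∈ V(K_u), x ∈ V(K_g).
-- The partite set V_i is { v | proj₁ v ≡ i }.
Vertex : ℕ → ℕ → Set
Vertex u g = Fin u × Fin g

Adj : ∀ {u g} → Vertex u g → Vertex u g → Set
Adj v w = (proj₁ v ≢ proj₁ w) × (proj₂ v ≢ proj₂ w)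

next : ∀ {n} → Fin n → Fin n
next {suc n} i = fromℕ< (m%n<n (suc (toℕ i)) (suc n))

sumFin : (n : ℕ) → (Fin n → ℕ) → ℕ
sumFin zero    f = 0
sumFin (suc n) f = f zero + sumFin n (λ i → f (suc i))

_≟V_ : ∀ {u g} (v w : Vertex u g) → Dec (v ≡ w)
(a , x) ≟V (b , y) with a ≟ b | x ≟ y
... | yes Relation.Binary.PropositionalEquality.refl | yes Relation.Binary.PropositionalEquality.refl = yes Relation.Binary.PropositionalEquality.refl
... | no ne | _ = no (λ { Relation.Binary.PropositionalEquality.refl → ne Relation.Binary.PropositionalEquality.refl })
... | yes _ | no ne = no (λ { Relation.Binary.PropositionalEquality.refl → ne Relation.Binary.PropositionalEquality.refl })

sameEdge : ∀ {u g} → (a b v w : Vertex u g) → ℕ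
sameEdge a b v w with ((a ≟V v) ×-dec (b ≟V w)) ⊎-dec ((a ≟V w) ×-dec (b ≟V v))
... | yes _ = 1
... | no  _ = 0

-- A partial C_k-factor of K_u × K_g (as a simple subgraph; its edges are
-- edges of K_u × K_g): a family of vertex-disjoint k-cycles covering
-- exactly the vertices outside V_removed.
-- A k-cycle is an injective map Fin k → vertices with position j adjacent
-- to position next j; its edges are {cyc j , cyc (next j)}.
record PartialCkFactor (k u g : ℕ) : Set where
  field
    removed  : Fin u
    ncyc     : ℕ
    cyc      : Fin ncyc → Fin k → Vertex u g
    cyc-inj  : ∀ c → Injective _≡_ _≡_ (cyc c)
    cyc-adj  : ∀ c j → Adj (cyc c j) (cyc c (next j))
    disjoint : ∀ c c′ j j′ → cyc c j ≡ cyc c′ j′ → c ≡ c′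
    avoid    : ∀ c j → proj₁ (cyc c j) ≢ removed
    cover    : ∀ (v : Vertex u g) → proj₁ v ≢ removed → ∃[ c ] ∃[ j ] cyc c j ≡ v

open PartialCkFactor public

edgeCount : ∀ {k u g} → PartialCkFactor k u g → Vertex u g → Vertex u g → ℕ
edgeCount {k} F v w =
  sumFin (ncyc F) (λ c → sumFin k (λ j → sameEdge (cyc F c j) (cyc F c (next j)) v w))

-- A k-ARCS of (K_u × K_g)(mult): a finite family of partial C_k-factors
-- partitioning the edge multiset, i.e. every edge of K_u × K_g is used
-- exactly mult times in total (edges of the factors are edges of K_u × K_g
-- by cyc-adj, so nothing else is used).
record ARCS (k u g mult : ℕ) : Set where
  field
    nfac     : ℕ
    factor   : Fin nfac → PartialCkFactor k u g
    partition : ∀ (v w : Vertex u g) → Adj v w →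
                sumFin nfac (λ f → edgeCount (factor f) v w) ≡ mult

{-# OPTIONS --safe #-}
module Submission where

-- Write k = m n with m = p₁⋯pᵢ = 2h even and n = pᵢ₊₁⋯pₜ odd, u = 1 + s m and g = n w.
--
-- Base: K_u(2) has, for each vertex i, a set of s m-cycles covering everything but i, every edge
-- being used twice in total.  For s = 1, 2 these come from zigzag paths in ℤ_u, developed
-- cyclically.  For s ≥ 3, take a family of pairings of 2s blocks of size h (a one-frame whose
-- groups are s pairs of blocks), replace each pair of blocks by Hamilton cycles of K_{h,h}, and
-- put the case s = 1 on each group together with one additional vertex.
--
-- Lift: in ℤ_g let e = w, of order n.  For ρ ≠ 0 give the arcs of an m-cycle the voltages
-- ρ, τ − ρ, ρ − τ, τ − ρ, …, τ − ρ, with total τ = e, or τ = 2e when ρ = e.  The total has order n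
-- because n is odd, so an m-cycle lifts to k-cycles; and as ρ runs over ℤ_g ∖ {0}, so does each
-- single voltage, hence every edge of K_g is met once over each edge of the base.
--
-- Only the existence of cycles through prescribed vertices and edges is verified: as the numbers of
-- vertices and edges to be covered agree with the numbers available, nothing is covered twice.
-- The two copies of an edge are told apart by a colouring of the cycle edges.

open import Defs
import Data.Nat as ℕ
import Data.Nat.Properties as ℕₚ
import Data.Nat.Tactic.RingSolver as ℕˢ
import Data.Bool.Properties as Bₚ
import Data.Fin as F
import Data.Fin.Properties as Fₚ
import Data.Integer.Properties as ℤₚ
import Data.List.Properties as Lₚ
import Data.List.Relation.Unary.Any as Any
open import Algebra.Properties.CommutativeSemigroup ℕₚ.+-commutativeSemigroup using () renaming (interchange to +-interchange)
open import Data.Bool using (Bool; true; false; not; _xor_; if_then_else_)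
open import Data.Fin using (Fin; zero; suc; toℕ; fromℕ<; punchIn; punchOut; combine; remQuot; splitAt; join)
open import Data.List using (_∷_)
open import Data.Maybe using (Maybe; just; nothing)
open import Data.Nat using (ℕ; zero; suc; _≤_; _<_; z≤n; s≤s; NonZero)
open import Data.Nat.DivMod using (_/_; _%_; m%n<n; m≡m%n+[m/n]*n; [m+kn]%n≡m%n; m<n⇒m%n≡m; n%n≡0; +-distrib-/-∣ʳ; m*n/n≡m; m<n⇒m/n≡0)
open import Data.Nat.Divisibility using (divides; ∣-trans; ∣⇒≤; n∣m*n)
open import Data.Nat.ListAction.Properties using (product-++; ∈⇒∣product)
open import Data.Nat.Primality using (euclidsLemma; prime[2]; prime⇒nonTrivial)
open import Data.List.Relation.Unary.All using ([]; _∷_)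
open import Data.List.Relation.Unary.All.Properties using (drop⁺)
open import Data.Product using (_×_; _,_; proj₁; proj₂; ∃; ∃-syntax; uncurry)
open import Data.Product.Function.NonDependent.Propositional using (_×-↔_)
open import Data.Product.Properties using (,-injectiveˡ; ,-injectiveʳ)
open import Data.Sum using (_⊎_; inj₁; inj₂; [_,_]′)
open import Function using (_∘_; _↔_; Inverse; mk↔ₛ′)
open import Function.Construct.Composition using (_↔-∘_)
open import Function.Construct.Identity using (↔-id)
open import Function.Construct.Symmetry using (↔-sym)
open import Function.Definitions using (Injective)
open import Relation.Binary.PropositionalEquality
open import Relation.Nullary using (¬_; yes; no; does; contradiction)
open import Relation.Nullary.Decidable using (_×-dec_; _⊎-dec_; dec-true; dec-false)

-- Pigeonhole arguments on finite sets.

Fin-injective⇒surjective : ∀ {n} (f : Fin n → Fin n) → Injective _≡_ _≡_ f → ∀ y → ∃[ x ] f x ≡ y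
Fin-injective⇒surjective {zero}  f inj ()
Fin-injective⇒surjective {suc n} f inj y with Fₚ.any? (λ x → f x F.≟ y)
... | yes p = p
... | no ¬p = contradiction (Fₚ.injective⇒≤ {f = f′} f′-inj) (ℕₚ.<⇒≱ ℕₚ.≤-refl)
  where
  y≢ : ∀ x → y ≢ f x
  y≢ x e = ¬p (x , sym e)
  f′ : Fin (suc n) → Fin n
  f′ x = punchOut (y≢ x)
  f′-inj : Injective _≡_ _≡_ f′
  f′-inj {a} {b} e = inj (Fₚ.punchOut-injective (y≢ a) (y≢ b) e)

abstract
  injective⇒surjective : ∀ {n} {X Y : Set} → Fin n ↔ X → Fin n ↔ Y →
    (f : X → Y) → Injective _≡_ _≡_ f → ∀ y → ∃[ x ] f x ≡ y
  injective⇒surjective {n} I J f inj y =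
    let x , e = Fin-injective⇒surjective h h-injective (B.from y)
    in A.to x , B.from-injective e
    where
    module A = Inverse I
    module B where
      open Inverse J public
      from-injective : Injective _≡_ _≡_ from
      from-injective e = trans (sym (strictlyInverseˡ _)) (trans (cong to e) (strictlyInverseˡ _))
    h : Fin n → Fin n
    h k = B.from (f (A.to k))
    h-injective : Injective _≡_ _≡_ h
    h-injective e = trans (sym (A.strictlyInverseʳ _))
      (trans (cong A.from (inj (B.from-injective e))) (A.strictlyInverseʳ _))

module _ {N : ℕ} {P Y V : Set} (P-finite : Fin N ↔ P) (Y-finite : Fin N ↔ Y)
  (image : Y → V) (image-injective : Injective _≡_ _≡_ image)
  (f : P → V) (hit : ∀ y → ∃[ p ] f p ≡ image y) where

  private
    -- Choosing for each `y` a point that hits `image y` gives an injection from `Y` to `P`. Both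
    -- have `N` elements, so it is onto and every point of `P` is a chosen one.
    section-surjective : ∀ p → ∃[ y ] proj₁ (hit y) ≡ p
    section-surjective = injective⇒surjective Y-finite P-finite (proj₁ ∘ hit)
      λ {y} {y′} e → image-injective (trans (sym (proj₂ (hit y))) (trans (cong f e) (proj₂ (hit y′))))

  exact-image : ∀ p → ∃[ y ] f p ≡ image y
  exact-image p = let y , e = section-surjective p in y , trans (cong f (sym e)) (proj₂ (hit y))

  -- Every point is a chosen one, and chosen points with equal values belong to the same `y`.
  exact-injective : Injective _≡_ _≡_ f
  exact-injective {p} {q} e =
    let y , ey = section-surjective p
        z , ez = section-surjective q
    in trans (sym ey) (trans (cong (proj₁ ∘ hit) (image-injective
         (trans (sym (proj₂ (hit y))) (trans (cong f ey) (trans e (trans (cong f (sym ez)) (proj₂ (hit z)))))))) ez)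

Joins : ∀ {V : Set} → V → V → V → V → Set
Joins a b v w = (a ≡ v × b ≡ w) ⊎ (a ≡ w × b ≡ v)

×-finite : ∀ {a b} {A B : Set} → Fin a ↔ A → Fin b ↔ B → Fin (a ℕ.* b) ↔ (A × B)
×-finite {a} {b} I J = (I ×-↔ J) ↔-∘ Fₚ.*↔× {a} {b}

-- Finite sums and edge multiplicities.

sumFin-zero : ∀ n (f : Fin n → ℕ) → (∀ i → f i ≡ 0) → sumFin n f ≡ 0
sumFin-zero zero    f z = refl
sumFin-zero (suc n) f z = cong₂ ℕ._+_ (z zero) (sumFin-zero n (f ∘ suc) (z ∘ suc))

sumFin-single : ∀ n (f : Fin n → ℕ) i₀ → f i₀ ≡ 1 → (∀ i → i ≢ i₀ → f i ≡ 0) → sumFin n f ≡ 1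
sumFin-single (suc n) f zero     one z = cong₂ ℕ._+_ one (sumFin-zero n (f ∘ suc) (λ i → z (suc i) λ ()))
sumFin-single (suc n) f (suc i₀) one z =
  cong₂ ℕ._+_ (z zero λ ()) (sumFin-single n (f ∘ suc) i₀ one (λ i ne → z (suc i) (ne ∘ Fₚ.suc-injective)))

sumFin-cong : ∀ n {f g : Fin n → ℕ} → (∀ i → f i ≡ g i) → sumFin n f ≡ sumFin n g
sumFin-cong zero    e = refl
sumFin-cong (suc n) e = cong₂ ℕ._+_ (e zero) (sumFin-cong n (e ∘ suc))

sumFin-+ : ∀ n (f g : Fin n → ℕ) → sumFin n (λ i → f i ℕ.+ g i) ≡ sumFin n f ℕ.+ sumFin n g
sumFin-+ zero    f g = refl
sumFin-+ (suc n) f g = trans (cong (f zero ℕ.+ g zero ℕ.+_) (sumFin-+ n (f ∘ suc) (g ∘ suc)))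
  (+-interchange (f zero) (g zero) (sumFin n (f ∘ suc)) (sumFin n (g ∘ suc)))

sumFin³ : ∀ a b c → (Fin a → Fin b → Fin c → ℕ) → ℕ
sumFin³ a b c X = sumFin a λ i → sumFin b λ j → sumFin c λ l → X i j l

sumFin³-single : ∀ a b c (X : Fin a → Fin b → Fin c → ℕ) i₀ j₀ l₀ → X i₀ j₀ l₀ ≡ 1 →
  (∀ i j l → (i , j , l) ≢ (i₀ , j₀ , l₀) → X i j l ≡ 0) → sumFin³ a b c X ≡ 1
sumFin³-single a b c X i₀ j₀ l₀ one z =
  sumFin-single a _ i₀
    (sumFin-single b _ j₀
      (sumFin-single c _ l₀ one (λ l ne → z i₀ j₀ l λ { refl → ne refl }))
      (λ j ne → sumFin-zero c _ (λ l → z i₀ j l λ { refl → ne refl })))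
    (λ i ne → sumFin-zero b _ (λ j → sumFin-zero c _ (λ l → z i j l λ { refl → ne refl })))

sumFin³-+ : ∀ a b c (X Y : Fin a → Fin b → Fin c → ℕ) →
  sumFin³ a b c (λ i j l → X i j l ℕ.+ Y i j l) ≡ sumFin³ a b c X ℕ.+ sumFin³ a b c Y
sumFin³-+ a b c X Y = trans (sumFin-cong a (λ i → trans (sumFin-cong b (λ j → sumFin-+ c (X i j) (Y i j)))
   (sumFin-+ b _ _))) (sumFin-+ a _ _)

sumFin³-cong : ∀ a b c {X Y : Fin a → Fin b → Fin c → ℕ} → (∀ i j l → X i j l ≡ Y i j l) →
  sumFin³ a b c X ≡ sumFin³ a b c Y
sumFin³-cong a b c e = sumFin-cong a (λ i → sumFin-cong b (λ j → sumFin-cong c (e i j)))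

sameEdge-yes : ∀ {u g} {a b v w : Vertex u g} → Joins a b v w → sameEdge a b v w ≡ 1
sameEdge-yes {a = a} {b} {v} {w} p with ((a ≟V v) ×-dec (b ≟V w)) ⊎-dec ((a ≟V w) ×-dec (b ≟V v))
... | yes _ = refl
... | no ¬p = contradiction p ¬p

sameEdge-no : ∀ {u g} {a b v w : Vertex u g} → ¬ Joins a b v w → sameEdge a b v w ≡ 0
sameEdge-no {a = a} {b} {v} {w} ¬p with ((a ≟V v) ×-dec (b ≟V w)) ⊎-dec ((a ≟V w) ×-dec (b ≟V v))
... | yes p = contradiction p ¬p
... | no _ = refl

-- Splits a count by colour, so that the two copies of an edge can be counted separately.
only : Bool → Bool → ℕ → ℕ
only false false n = n
only true  true  n = n
only _     _     n = 0

only-split : ∀ b n → n ≡ only false b n ℕ.+ only true b n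
only-split false n = sym (ℕₚ.+-identityʳ n)
only-split true  n = refl

only-same : ∀ b n → only b b n ≡ n
only-same false n = refl
only-same true  n = refl

only-zero : ∀ b c n → (b ≡ c → n ≡ 0) → only b c n ≡ 0
only-zero false false n z = z refl
only-zero true  true  n z = z refl
only-zero false true  n z = refl
only-zero true  false n z = refl

-- The wrap-around of `next` at the last position is absorbed by closedness, so cycles can be
-- handled as closed walks indexed by ℕ.
toℕ-next : ∀ {k} {V : Set} (f : ℕ → V) → f k ≡ f 0 → (j : Fin k) → f (toℕ (next j)) ≡ f (suc (toℕ j))
toℕ-next {suc k} f closed j with ℕₚ.m≤n⇒m<n∨m≡n (Fₚ.toℕ<n j)
... | inj₁ lt = cong f (trans (Fₚ.toℕ-fromℕ< _) (m<n⇒m%n≡m lt))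
... | inj₂ eq = trans (cong f (trans (Fₚ.toℕ-fromℕ< _) (trans (cong (ℕ._% suc k) eq) (n%n≡0 (suc k)))))
                      (trans (sym closed) (cong f (sym eq)))

dart-count : ∀ u u′ g g′ → ((u ℕ.* g′) ℕ.* (u′ ℕ.* g)) ℕ.* 2 ≡ (u ℕ.* u′) ℕ.* ((g ℕ.* g′) ℕ.* 2)
dart-count = ℕˢ.solve-∀

-- From coverings of the right size to an exact decomposition.

module CoveringToARCS
  (k u-1 g-1 nf nc : ℕ)
  (cyc    : Fin nf → Fin nc → ℕ → Vertex (suc u-1) (suc g-1))
  (rem    : Fin nf → Fin (suc u-1))
  (col    : Fin nf → Fin nc → ℕ → Bool)
  (closed : ∀ f c → cyc f c k ≡ cyc f c 0)
  (adj    : ∀ f c r → r < k → Adj (cyc f c r) (cyc f c (suc r)))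
  (cover  : ∀ f v → proj₁ v ≢ rem f → ∃[ c ] ∃[ r ] (r < k × cyc f c r ≡ v))
  (edge   : ∀ b v w → Adj v w → ∃[ f ] ∃[ c ] ∃[ r ]
              (r < k × col f c r ≡ b × Joins (cyc f c r) (cyc f c (suc r)) v w))
  (nf-size : nf ≡ suc u-1 ℕ.* g-1)
  (nc-size : nc ℕ.* k ≡ u-1 ℕ.* suc g-1)
  where

  private
    u g : ℕ
    u = suc u-1
    g = suc g-1

    cycF : Fin nf → Fin nc → Fin k → Vertex u g
    cycF f c j = cyc f c (toℕ j)

    cycF-next : ∀ f c j → cycF f c (next j) ≡ cyc f c (suc (toℕ j))
    cycF-next f c j = toℕ-next (cyc f c) (closed f c) j

    -- `punchIn` parametrises the vertices off the removed part by a product, which makes their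
    -- number visible.
    outside : ∀ f → Fin u-1 × Fin g → Vertex u g
    outside f (a , x) = punchIn (rem f) a , x

    outside-injective : ∀ f → Injective _≡_ _≡_ (outside f)
    outside-injective f {a , x} {a′ , x′} e =
      cong₂ _,_ (Fₚ.punchIn-injective (rem f) a a′ (,-injectiveˡ e)) (,-injectiveʳ e)

    outside-hit : ∀ f y → ∃[ p ] uncurry (cycF f) p ≡ outside f y
    outside-hit f (a , x) = let c , r , r<k , e = cover f (punchIn (rem f) a , x) (Fₚ.punchInᵢ≢i (rem f) a)
      in (c , fromℕ< r<k) , trans (cong (cyc f c) (Fₚ.toℕ-fromℕ< r<k)) e

    positions : Fin (u-1 ℕ.* g) ↔ (Fin nc × Fin k)
    positions = subst (λ N → Fin N ↔ (Fin nc × Fin k)) nc-size (Fₚ.*↔× {nc} {k})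

    -- By `nc-size` a factor has as many positions as there are vertices to cover, so covering them
    -- all forces injectivity. Disjointness of the cycles and injectivity of each one are read off
    -- from this.
    cycF-injective : ∀ f → Injective _≡_ _≡_ (uncurry (cycF f))
    cycF-injective f = exact-injective positions (Fₚ.*↔× {u-1} {g})
      (outside f) (outside-injective f) (uncurry (cycF f)) (outside-hit f)

    cycF-outside : ∀ f p → ∃[ y ] uncurry (cycF f) p ≡ outside f y
    cycF-outside f = exact-image positions (Fₚ.*↔× {u-1} {g})
      (outside f) (outside-injective f) (uncurry (cycF f)) (outside-hit f)

    partialFactor : Fin nf → PartialCkFactor k u g
    partialFactor f = record
      { removed  = rem f
      ; ncyc     = nc
      ; cyc      = cycF f
      ; cyc-inj  = λ c {j} {j′} e → cong proj₂ (cycF-injective f {c , j} {c , j′} e)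
      ; cyc-adj  = λ c j → subst (Adj (cycF f c j)) (sym (cycF-next f c j)) (adj f c (toℕ j) (Fₚ.toℕ<n j))
      ; disjoint = λ c c′ j j′ e → cong proj₁ (cycF-injective f {c , j} {c′ , j′} e)
      ; avoid    = avoid′
      ; cover    = cover′
      }
      where
      avoid′ : ∀ c j → proj₁ (cycF f c j) ≢ rem f
      avoid′ c j e = let y , p = cycF-outside f (c , j)
        in Fₚ.punchInᵢ≢i (rem f) (proj₁ y) (trans (cong proj₁ (sym p)) e)
      cover′ : ∀ v → proj₁ v ≢ rem f → ∃[ c ] ∃[ j ] cycF f c j ≡ v
      cover′ v ne with cover f v ne
      ... | c , r , r<k , e = c , fromℕ< r<k , trans (cong (cyc f c) (Fₚ.toℕ-fromℕ< r<k)) e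

    Incidence : Set
    Incidence = Fin nf × Fin nc × Fin k

    -- The Boolean is a direction of traversal: `false` leaves position `j`, `true` returns to it.
    source target : Incidence → Bool → Vertex u g
    source (f , c , j) false = cyc f c (toℕ j)
    source (f , c , j) true  = cyc f c (suc (toℕ j))
    target e b = source e (not b)

    colour : Incidence → Bool
    colour (f , c , j) = col f c (toℕ j)

    -- Ordered pairs of adjacent vertices with a colour. Encoding the two inequalities by `punchIn`
    -- turns their number into a product.
    ColouredPair : Set
    ColouredPair = (Fin u × Fin u-1) × (Fin g × Fin g-1) × Bool

    tail head : ColouredPair → Vertex u g
    tail ((a , a′) , (x , x′) , b) = a , x
    head ((a , a′) , (x , x′) , b) = punchIn a a′ , punchIn x x′

    tint : ColouredPair → Bool
    tint (_ , _ , b) = b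

    pair-adj : ∀ p → Adj (tail p) (head p)
    pair-adj ((a , a′) , (x , x′) , b) = Fₚ.punchInᵢ≢i a a′ ∘ sym , Fₚ.punchInᵢ≢i x x′ ∘ sym

    ends : ColouredPair → Vertex u g × Vertex u g × Bool
    ends p = tail p , head p , tint p

    ends-injective : Injective _≡_ _≡_ ends
    ends-injective {(a , a′) , (x , x′) , b} {(c , c′) , (z , z′) , b′} e
      with refl ← ,-injectiveˡ e | h ← ,-injectiveˡ (,-injectiveʳ e) | refl ← ,-injectiveʳ (,-injectiveʳ e) =
      cong₂ (λ s t → (a , s) , (x , t) , b)
        (Fₚ.punchIn-injective a a′ c′ (,-injectiveˡ h)) (Fₚ.punchIn-injective x x′ z′ (,-injectiveʳ h))

    dartEnds : Incidence × Bool → Vertex u g × Vertex u g × Bool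
    dartEnds (e , b) = source e b , target e b , colour e

    ends-hit : ∀ p → ∃[ d ] dartEnds d ≡ ends p
    ends-hit p with edge (tint p) (tail p) (head p) (pair-adj p)
    ... | f , c , r , r<k , cl , jn
      with fromℕ< r<k | Fₚ.toℕ-fromℕ< r<k
    ...   | j | refl with jn
    ...     | inj₁ (p₁ , p₂) = ((f , c , j) , false) , cong₂ _,_ p₁ (cong₂ _,_ p₂ cl)
    ...     | inj₂ (p₁ , p₂) = ((f , c , j) , true) , cong₂ _,_ p₂ (cong₂ _,_ p₁ cl)

    -- By `nf-size` and `nc-size`, directed incidences and coloured ordered pairs are equinumerous,
    -- and every coloured pair is hit; hence none is hit twice.
    dartEnds-injective : Injective _≡_ _≡_ dartEnds
    dartEnds-injective = exact-injective (subst (λ N → Fin N ↔ (Incidence × Bool)) sizes incidences) pairs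
      ends ends-injective dartEnds ends-hit
      where
      incidences : Fin ((nf ℕ.* (nc ℕ.* k)) ℕ.* 2) ↔ (Incidence × Bool)
      incidences = ×-finite (×-finite (↔-id (Fin nf)) (×-finite (↔-id (Fin nc)) (↔-id (Fin k)))) Fₚ.2↔Bool
      pairs : Fin ((u ℕ.* u-1) ℕ.* ((g ℕ.* g-1) ℕ.* 2)) ↔ ColouredPair
      pairs = ×-finite (×-finite (↔-id (Fin u)) (↔-id (Fin u-1)))
                (×-finite (×-finite (↔-id (Fin g)) (↔-id (Fin g-1))) Fₚ.2↔Bool)
      sizes : (nf ℕ.* (nc ℕ.* k)) ℕ.* 2 ≡ (u ℕ.* u-1) ℕ.* ((g ℕ.* g-1) ℕ.* 2)
      sizes = trans (cong₂ (λ x y → (x ℕ.* y) ℕ.* 2) nf-size nc-size) (dart-count u u-1 g g-1)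

    JoinedBy : Incidence → Vertex u g → Vertex u g → Set
    JoinedBy e = Joins (source e false) (source e true)

    oriented : ∀ e {v w} → JoinedBy e v w → ∃[ b ] dartEnds (e , b) ≡ (v , w , colour e)
    oriented e (inj₁ (p , q)) = false , cong₂ _,_ p (cong (_, colour e) q)
    oriented e (inj₂ (p , q)) = true , cong₂ _,_ q (cong (_, colour e) p)

    -- Orienting both incidences from `v` to `w` reduces this to injectivity of `dartEnds`.
    joining-unique : ∀ e e′ {v w} → JoinedBy e v w → JoinedBy e′ v w → colour e ≡ colour e′ → e ≡ e′
    joining-unique e e′ {v} {w} p p′ c =
      let b , r = oriented e p
          b′ , r′ = oriented e′ p′
      in cong proj₁ (dartEnds-injective {e , b} {e′ , b′}
           (trans r (trans (cong (λ c → v , w , c) c) (sym r′))))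

    module _ (v w : Vertex u g) (vw : Adj v w) where

      term : Fin nf → Fin nc → Fin k → ℕ
      term f c j = sameEdge (cycF f c j) (cycF f c (next j)) v w

      -- `edge` supplies an incidence of colour `b` and `joining-unique` excludes a second one. The
      -- two colours together give multiplicity 2.
      colour-count : ∀ b → sumFin³ nf nc k (λ f c j → only b (colour (f , c , j)) (term f c j)) ≡ 1
      colour-count b = let f , c , r , r<k , cl , jn = edge b v w vw in count f c r r<k cl jn
        where
        count : ∀ f₀ c₀ r → r < k → col f₀ c₀ r ≡ b → Joins (cyc f₀ c₀ r) (cyc f₀ c₀ (suc r)) v w →
          sumFin³ nf nc k (λ f c j → only b (colour (f , c , j)) (term f c j)) ≡ 1
        count f₀ c₀ r r<k cl jn = sumFin³-single nf nc k _ f₀ c₀ j₀ one others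
          where
          j₀ : Fin k
          j₀ = fromℕ< r<k
          toℕj₀ : toℕ j₀ ≡ r
          toℕj₀ = Fₚ.toℕ-fromℕ< r<k
          cl₀ : colour (f₀ , c₀ , j₀) ≡ b
          cl₀ = trans (cong (col f₀ c₀) toℕj₀) cl
          jn₀ : JoinedBy (f₀ , c₀ , j₀) v w
          jn₀ = subst (λ r → Joins (cyc f₀ c₀ r) (cyc f₀ c₀ (suc r)) v w) (sym toℕj₀) jn
          one : only b (colour (f₀ , c₀ , j₀)) (term f₀ c₀ j₀) ≡ 1
          one = trans (cong (λ x → only b x (term f₀ c₀ j₀)) cl₀) (trans (only-same b _)
            (sameEdge-yes (subst (λ t → Joins (cycF f₀ c₀ j₀) t v w) (sym (cycF-next f₀ c₀ j₀)) jn₀)))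
          others : ∀ f c j → (f , c , j) ≢ (f₀ , c₀ , j₀) → only b (colour (f , c , j)) (term f c j) ≡ 0
          others f c j ne = only-zero b _ _ λ b≡ → sameEdge-no λ p →
            ne (joining-unique (f , c , j) (f₀ , c₀ , j₀)
                 (subst (λ t → Joins (cycF f c j) t v w) (cycF-next f c j) p) jn₀ (trans (sym b≡) (sym cl₀)))

      total : sumFin³ nf nc k term ≡ 2
      total = trans (sumFin³-cong nf nc k (λ f c j → only-split (colour (f , c , j)) (term f c j)))
        (trans (sumFin³-+ nf nc k _ _) (cong₂ ℕ._+_ (colour-count false) (colour-count true)))

  arcs : ARCS k u g 2
  arcs = record { nfac = nf ; factor = partialFactor ; partition = total }

module _ where

  open import Data.Integer using (ℤ; +_; -[1+_]; _+_; _*_; -_; _-_; 0ℤ; 1ℤ)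
  open import Data.Integer.DivMod using (_/ℕ_; n%ℕd<d; a≡a%ℕn+[a/ℕn]*n)
  open import Data.Integer.Tactic.RingSolver using (solve-∀)
  open import Data.Nat using (_∸_)

  -- Integers modulo n.

  module Mod (n-1 : ℕ) where
    modulus : ℤ
    modulus = + suc n-1

    infix 4 _≈_
    record _≈_ (a b : ℤ) : Set where
      constructor _,_
      field
        multiple : ℤ
        shifted  : a ≡ b + multiple * modulus

    open _≈_ public

    ι : Fin (suc n-1) → ℤ
    ι x = + toℕ x

    res : ℤ → Fin (suc n-1)
    res z = fromℕ< (n%ℕd<d z (suc n-1))

    ≈-refl : ∀ {a} → a ≈ a
    ≈-refl {a} = 0ℤ , sym (ℤₚ.+-identityʳ a)

    ≡⇒≈ : ∀ {a b} → a ≡ b → a ≈ b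
    ≡⇒≈ refl = ≈-refl

    ≈-sym : ∀ {a b} → a ≈ b → b ≈ a
    ≈-sym {b = b} (k , e) = - k , trans (lem b k modulus) (cong (_+ - k * modulus) (sym e))
      where lem : ∀ b k n → b ≡ b + k * n + - k * n
            lem = solve-∀

    ≈-trans : ∀ {a b c} → a ≈ b → b ≈ c → a ≈ c
    ≈-trans {c = c} (k , refl) (l , refl) = k + l , lem c k l modulus
      where lem : ∀ c k l n → c + l * n + k * n ≡ c + (k + l) * n
            lem = solve-∀

    +-cong : ∀ {a b c d} → a ≈ b → c ≈ d → a + c ≈ b + d
    +-cong {b = b} {d = d} (k , refl) (l , refl) = k + l , lem b d k l modulus
      where lem : ∀ b d k l n → (b + k * n) + (d + l * n) ≡ b + d + (k + l) * n
            lem = solve-∀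

    neg-cong : ∀ {a b} → a ≈ b → - a ≈ - b
    neg-cong {b = b} (k , refl) = - k , lem b k modulus
      where lem : ∀ b k n → - (b + k * n) ≡ - b + - k * n
            lem = solve-∀

    ι-res : ∀ z → ι (res z) ≈ z
    ι-res z = ≈-sym (z /ℕ suc n-1 , trans (a≡a%ℕn+[a/ℕn]*n z (suc n-1))
      (cong (λ r → + r + (z /ℕ suc n-1) * modulus) (sym (Fₚ.toℕ-fromℕ< (n%ℕd<d z (suc n-1))))))

    private
      -- The right-hand side is at least the modulus, since `b` is natural and the multiple is
      -- positive.
      below : ∀ {a b} → a < suc n-1 → ∀ k → ¬ (+ a ≡ + b + + suc k * modulus)
      below {a} {b} a<n k e = ℕₚ.<⇒≱ a<n (ℕₚ.≤-trans (ℕₚ.m≤m+n (suc n-1) (k ℕ.* suc n-1))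
        (ℕₚ.≤-trans (ℕₚ.m≤n+m _ b) (ℕₚ.≤-reflexive (sym (ℤₚ.+-injective
          (trans e (cong (λ t → + b + t) (sym (ℤₚ.pos-* (suc k) (suc n-1))))))))))

    ι-injective : ∀ {x y} → ι x ≈ ι y → x ≡ y
    ι-injective {x} {y} (+ zero , e) = Fₚ.toℕ-injective (ℤₚ.+-injective (trans e (ℤₚ.+-identityʳ (ι y))))
    ι-injective {x} {y} (+ suc k , e) = contradiction e (below {b = toℕ y} (Fₚ.toℕ<n x) k)
    ι-injective {x} {y} (-[1+ k ] , e) = contradiction (shifted (≈-sym {ι x} {ι y} (-[1+ k ] , e))) (below {b = toℕ x} (Fₚ.toℕ<n y) k)

    res-cong : ∀ {a b} → a ≈ b → res a ≡ res b
    res-cong {a} {b} e = ι-injective (≈-trans (ι-res a) (≈-trans e (≈-sym (ι-res b))))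

    res-ι : ∀ x → res (ι x) ≡ x
    res-ι x = ι-injective (ι-res (ι x))

    res≡⇒≈ : ∀ {a b} → res a ≡ res b → a ≈ b
    res≡⇒≈ {a} {b} e = ≈-trans (≈-sym (ι-res a)) (≈-trans (≡⇒≈ (cong ι e)) (ι-res b))

  -- tour i c is a closed walk of length m; the walks tour i 0, …, tour i (s-1) avoid i.
  -- The edge at position r of the walk has colour hue i c r.
  record NearSystem (m s : ℕ) (U : Set) : Set where
    field
      tour   : U → Fin s → ℕ → U
      hue    : U → Fin s → ℕ → Bool
      closed : ∀ i c → tour i c m ≡ tour i c 0
      visits : ∀ i v → v ≢ i → ∃[ c ] ∃[ r ] (r < m × tour i c r ≡ v)
      joined : ∀ b v w → v ≢ w → ∃[ i ] ∃[ c ] ∃[ r ]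
                 (r < m × hue i c r ≡ b × Joins (tour i c r) (tour i c (suc r)) v w)

  module _ {m s : ℕ} (N : NearSystem m s (Fin (suc (s ℕ.* m)))) where
    open NearSystem N

    -- The `s * m` positions cover the `s * m` vertices other than `i`, so no vertex is met twice.
    near-injective : ∀ i → Injective _≡_ _≡_ (λ (p : Fin s × Fin m) → tour i (proj₁ p) (toℕ (proj₂ p)))
    near-injective i = exact-injective (Fₚ.*↔× {s} {m}) (↔-id (Fin (s ℕ.* m)))
      (punchIn i) (λ {a} {b} → Fₚ.punchIn-injective i a b) _ hit
      where
      hit : ∀ y → ∃[ p ] tour i (proj₁ p) (toℕ (proj₂ p)) ≡ punchIn i y
      hit y = let c , r , r<m , e = visits i (punchIn i y) (Fₚ.punchInᵢ≢i i y)
        in (c , fromℕ< r<m) , trans (cong (tour i c) (Fₚ.toℕ-fromℕ< r<m)) e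

    near-distinct : ∀ i c {r r′} → r < m → r′ < m → tour i c r ≡ tour i c r′ → r ≡ r′
    near-distinct i c r<m r′<m e = trans (sym (Fₚ.toℕ-fromℕ< r<m)) (trans (cong toℕ (cong proj₂
      (near-injective i {c , fromℕ< r<m} {c , fromℕ< r′<m}
        (trans (cong (tour i c) (Fₚ.toℕ-fromℕ< r<m)) (trans e (cong (tour i c) (sym (Fₚ.toℕ-fromℕ< r′<m)))))))) (Fₚ.toℕ-fromℕ< r′<m))

    near-adjacent : 2 ≤ m → ∀ i c r → r < m → tour i c r ≢ tour i c (suc r)
    near-adjacent 2≤m i c r r<m e with ℕₚ.m≤n⇒m<n∨m≡n r<m
    ... | inj₁ r+1<m = contradiction (near-distinct i c r<m r+1<m e) (ℕₚ.1+n≢n ∘ sym)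
    -- The successor of the last position is the start; a coincidence there would force length 1.
    ... | inj₂ refl with near-distinct i c r<m (ℕₚ.≤-trans (s≤s z≤n) 2≤m) (trans e (closed i c))
    ...   | refl = contradiction 2≤m λ { (s≤s ()) }

  -- Repeated turns around a cycle and their voltages.

  module _ (m : ℕ) .{{_ : NonZero m}} where

    div-at : ∀ {r} Q → r < m → (r ℕ.+ Q ℕ.* m) / m ≡ Q
    div-at {r} Q r<m = trans (+-distrib-/-∣ʳ r (n∣m*n Q))
      (cong₂ ℕ._+_ (m<n⇒m/n≡0 r<m) (m*n/n≡m Q m))

    mod-at : ∀ {r} Q → r < m → (r ℕ.+ Q ℕ.* m) % m ≡ r
    mod-at {r} Q r<m = trans ([m+kn]%n≡m%n r Q m) (m<n⇒m%n≡m r<m)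

    spiral : ∀ {V : Set} → (ℕ → ℕ → V) → ℕ → V
    spiral W j = W (j / m) (j % m)

    module _ {V : Set} (W : ℕ → ℕ → V) where
      spiral-at : ∀ {r} Q → r < m → spiral W (r ℕ.+ Q ℕ.* m) ≡ W Q r
      spiral-at Q r<m = cong₂ W (div-at Q r<m) (mod-at Q r<m)

      -- The last position of a turn is followed by the start of the next turn, which agrees with
      -- position `m` of the old one by `wrap`.
      spiral-suc : (∀ Q → W Q m ≡ W (suc Q) 0) → ∀ {r} Q → r < m → spiral W (suc (r ℕ.+ Q ℕ.* m)) ≡ W Q (suc r)
      spiral-suc wrap {r} Q r<m with ℕₚ.m≤n⇒m<n∨m≡n r<m
      ... | inj₁ r+1<m = spiral-at Q r+1<m
      ... | inj₂ refl = trans (spiral-at (suc Q) (s≤s z≤n)) (sym (wrap Q))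

  data Evef≥1 : ℕ → Set where
    two  : Evef≥1 2
    2+_  : ∀ {n} → Evef≥1 n → Evef≥1 (suc (suc n))

  -- The sum of the voltages before position r of a base cycle.
  voltage : ℤ → ℤ → ℕ → ℤ
  voltage ρ τ 0 = 0ℤ
  voltage ρ τ 1 = ρ
  voltage ρ τ 2 = τ
  voltage ρ τ (suc (suc (suc r))) = voltage ρ τ (suc r)

  voltage-even : ∀ ρ τ {n} → Evef≥1 n → voltage ρ τ n ≡ τ
  voltage-even ρ τ two = refl
  voltage-even ρ τ (2+ two) = refl
  voltage-even ρ τ (2+ (2+ e)) = voltage-even ρ τ (2+ e)

  -- After the initial arc the partial sums alternate between ρ and τ, so only three kinds of arc
  -- occur, with voltages ρ, τ - ρ and ρ - τ.
  data Step (r : ℕ) : Set where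
    first : (∀ ρ τ → voltage ρ τ r ≡ 0ℤ × voltage ρ τ (suc r) ≡ ρ) → Step r
    up    : (∀ ρ τ → voltage ρ τ r ≡ ρ × voltage ρ τ (suc r) ≡ τ) → Step r
    down  : (∀ ρ τ → voltage ρ τ r ≡ τ × voltage ρ τ (suc r) ≡ ρ) → Step r

  step : ∀ r → Step r
  step 0 = first λ ρ τ → refl , refl
  step 1 = up λ ρ τ → refl , refl
  step 2 = down λ ρ τ → refl , refl
  step (suc (suc (suc r))) with step (suc r)
  ... | first p = first p
  ... | up p = up p
  ... | down p = down p

  cancel : ∀ a b → a + (b - a) ≡ b
  cancel = solve-∀

  halve : ∀ q → ∃[ a ] (q ≡ a ℕ.* 2 ⊎ q ≡ suc (a ℕ.* 2))
  halve zero = 0 , inj₁ refl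
  halve (suc q) with halve q
  ... | a , inj₁ refl = a , inj₂ refl
  ... | a , inj₂ refl = suc a , inj₁ refl

  -- Halving modulo the odd number 2f + 1: an odd `q` becomes even once the modulus is added.
  halve-mod : ∀ f q → q < suc (f ℕ.* 2) →
    ∃[ Q ] (Q < suc (f ℕ.* 2) × (Q ℕ.+ Q ≡ q ⊎ Q ℕ.+ Q ≡ q ℕ.+ suc (f ℕ.* 2)))
  halve-mod f q q<n with halve q
  ... | a , inj₁ refl = a , ℕₚ.≤-<-trans (ℕₚ.m≤m*n a 2) q<n , inj₁ (lem a)
    where lem : ∀ a → a ℕ.+ a ≡ a ℕ.* 2
          lem = ℕˢ.solve-∀
  ... | a , inj₂ refl = suc (a ℕ.+ f) , s≤s (ℕₚ.≤-trans (ℕₚ.+-monoˡ-≤ f a<f) (ℕₚ.≤-reflexive (lem₁ f))) , inj₂ (lem₂ a f)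
    where
    a<f : a < f
    a<f = ℕₚ.*-cancelʳ-< 2 a f (ℕ.s≤s⁻¹ q<n)
    lem₁ : ∀ f → f ℕ.+ f ≡ f ℕ.* 2
    lem₁ = ℕˢ.solve-∀
    lem₂ : ∀ a f → suc (a ℕ.+ f) ℕ.+ suc (a ℕ.+ f) ≡ suc (a ℕ.* 2) ℕ.+ suc (f ℕ.* 2)
    lem₂ = ℕˢ.solve-∀

  -- Lifting the base cycles by voltages in ℤ_g.

  module Lift
    (m s f w g-1 : ℕ) .{{_ : NonZero m}} .{{_ : NonZero w}} (m-even : Evef≥1 m)
    (f≥1 : 1 ≤ f)
    (g≡ : suc (f ℕ.* 2) ℕ.* w ≡ suc g-1)
    (N : NearSystem m s (Fin (suc (s ℕ.* m))))
    where

    open NearSystem N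
    open Mod g-1

    private
      n u g : ℕ
      n = suc (f ℕ.* 2)
      u = suc (s ℕ.* m)
      g = suc g-1

      m≥2 : ∀ {m} → Evef≥1 m → 2 ≤ m
      m≥2 two = s≤s (s≤s z≤n)
      m≥2 (2+ e) = s≤s (s≤s z≤n)

      e : ℤ
      e = + w

      n*e : + n * e ≡ modulus
      n*e = trans (sym (ℤₚ.pos-* n w)) (cong +_ g≡)

      w<g : w < g
      w<g = subst (w <_) g≡ (ℕₚ.m<m+n w {f ℕ.* 2 ℕ.* w}
        (ℕₚ.*-mono-≤ {1} {f ℕ.* 2} {1} {w} (ℕₚ.*-mono-≤ f≥1 (s≤s (z≤n {1}))) (ℕ.>-nonZero⁻¹ w)))

      wF : Fin g
      wF = fromℕ< w<g

      ι-wF : ι wF ≡ e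
      ι-wF = cong +_ (Fₚ.toℕ-fromℕ< w<g)

      e≉0 : ¬ (e ≈ 0ℤ)
      e≉0 p = ℕ.≢-nonZero⁻¹ w (trans (sym (Fₚ.toℕ-fromℕ< w<g))
        (cong toℕ (ι-injective {wF} {zero} (≈-trans (≡⇒≈ ι-wF) p))))

      val : Fin g-1 → ℤ
      val ρ = ι (suc ρ)

      val≉0 : ∀ ρ → ¬ (val ρ ≈ 0ℤ)
      val≉0 ρ p with ι-injective {suc ρ} {zero} p
      ... | ()

      -- The total voltage τ of a base cycle. Taking `e + e` at ρ = e keeps τ - ρ nonzero there.
      turn : Fin g-1 → ℤ
      turn ρ with suc ρ F.≟ wF
      ... | yes _ = e + e
      ... | no _  = e

      data Turn (ρ : Fin g-1) : Set where
        double : val ρ ≡ e → turn ρ ≡ e + e → Turn ρ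
        single : ¬ (val ρ ≈ e) → turn ρ ≡ e → Turn ρ

      turn-view : ∀ ρ → Turn ρ
      turn-view ρ with suc ρ F.≟ wF in eq
      ... | yes p = double (trans (cong ι p) ι-wF) (lem eq)
        where lem : ∀ {q} → (suc ρ F.≟ wF) ≡ yes q → turn ρ ≡ e + e
              lem eq rewrite eq = refl
      ... | no ¬p = single (λ q → ¬p (ι-injective (≈-trans q (≡⇒≈ (sym ι-wF))))) (lem eq)
        where lem : ∀ {q} → (suc ρ F.≟ wF) ≡ no q → turn ρ ≡ e
              lem eq rewrite eq = refl

      nonzero : ∀ δ → ¬ (δ ≈ 0ℤ) → ∃[ ρ ] val ρ ≈ δ
      nonzero δ δ≉0 with res δ in eq
      ... | zero  = contradiction (≈-trans (≈-sym (ι-res δ)) (≡⇒≈ (cong ι eq))) δ≉0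
      ... | suc ρ = ρ , ≈-trans (≡⇒≈ (cong ι (sym eq))) (ι-res δ)

      sub≈0 : ∀ {a b} → a - b ≈ 0ℤ → a ≈ b
      sub≈0 {a} {b} p = ≈-trans (≡⇒≈ (sym (cancel b a))) (≈-trans (+-cong (≈-refl {b}) p) (≡⇒≈ (ℤₚ.+-identityʳ b)))

      -- ρ ↦ turn ρ − ρ permutes the nonzero residues: it is ρ ↦ e − ρ, except that it fixes e.
      complement : ∀ δ → ¬ (δ ≈ 0ℤ) → ∃[ ρ ] turn ρ - val ρ ≈ δ
      complement δ δ≉0 with res δ F.≟ wF
      ... | yes p = let ρ , v = nonzero e e≉0 in ρ , ≈-trans (is-double ρ v (turn-view ρ)) e≈δ
        where
        e≈δ : e ≈ δ
        e≈δ = ≈-trans (≡⇒≈ (trans (sym ι-wF) (cong ι (sym p)))) (ι-res δ)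
        is-double : ∀ ρ → val ρ ≈ e → Turn ρ → turn ρ - val ρ ≈ e
        is-double ρ v (single ¬v _) = contradiction v ¬v
        is-double ρ v (double p q) = ≡⇒≈ (trans (cong₂ _-_ q p) (lem e))
          where lem : ∀ e → e + e - e ≡ e
                lem = solve-∀
      ... | no ¬p = let ρ , v = nonzero (e - δ) (λ q → ¬p (trans (sym (res-cong (sub≈0 {e} {δ} q))) res-e))
                    in ρ , is-single ρ v (turn-view ρ)
        where
        res-e : res e ≡ wF
        res-e = trans (cong res (sym ι-wF)) (res-ι wF)
        lem : ∀ e δ → e - (e - δ) ≡ δ
        lem = solve-∀
        is-single : ∀ ρ → val ρ ≈ e - δ → Turn ρ → turn ρ - val ρ ≈ δ
        is-single ρ v (double p q) = contradiction
          (≈-trans (≡⇒≈ (sym (lem e δ))) (≈-trans (+-cong (≈-refl {e}) (neg-cong (≈-sym v)))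
            (≡⇒≈ (trans (cong (λ x → e - x) p) (ℤₚ.+-inverseʳ e))))) δ≉0
        is-single ρ v (single _ q) = ≈-trans (≡⇒≈ (cong (_- val ρ) q))
          (≈-trans (+-cong (≈-refl {e}) (neg-cong v)) (≡⇒≈ (lem e δ)))

      -- Each of the voltages ρ, τ - ρ and ρ - τ runs through all nonzero residues together with ρ:
      -- the first by `nonzero`, the other two by `complement`.
      realise : ∀ r δ → ¬ (δ ≈ 0ℤ) →
        ∃[ ρ ] voltage (val ρ) (turn ρ) r + δ ≈ voltage (val ρ) (turn ρ) (suc r)
      realise r δ δ≉0 with step r
      ... | first p = let ρ , v = nonzero δ δ≉0 ; a , b = p (val ρ) (turn ρ) in ρ ,
            ≈-trans (≡⇒≈ (trans (cong (_+ δ) a) (ℤₚ.+-identityˡ δ))) (≈-trans (≈-sym v) (≡⇒≈ (sym b)))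
      ... | up p = let ρ , v = complement δ δ≉0 ; a , b = p (val ρ) (turn ρ) in ρ ,
            ≈-trans (+-cong (≡⇒≈ a) (≈-sym v)) (≡⇒≈ (trans (cancel (val ρ) (turn ρ)) (sym b)))
      ... | down p = let ρ , v = complement (- δ) (λ q → δ≉0 (≈-trans (≡⇒≈ (sym (ℤₚ.neg-involutive δ))) (neg-cong q)))
                         a , b = p (val ρ) (turn ρ) in ρ ,
            ≈-trans (+-cong (≡⇒≈ a) (≈-trans (≡⇒≈ (sym (ℤₚ.neg-involutive δ))) (neg-cong (≈-sym v))))
              (≡⇒≈ (trans (lem (turn ρ) (val ρ)) (sym b)))
            where lem : ∀ t v → t + - (t - v) ≡ v
                  lem = solve-∀

      turn≉val : ∀ ρ → ¬ (turn ρ ≈ val ρ)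
      turn≉val ρ p with turn-view ρ
      ... | double q t = e≉0 (≈-trans (≡⇒≈ (sym (lem e))) (≈-trans (+-cong (≈-trans (≡⇒≈ (sym t)) (≈-trans p (≡⇒≈ q))) (≈-refl { - e}))
                            (≡⇒≈ (ℤₚ.+-inverseʳ e))))
            where lem : ∀ e → e + e - e ≡ e
                  lem = solve-∀
      ... | single ¬q t = ¬q (≈-trans (≈-sym p) (≡⇒≈ t))

      -- The voltages ρ and ±(τ - ρ) never vanish, so consecutive lifted vertices differ in the
      -- second coordinate, as adjacency in K_g demands.
      steps-move : ∀ ρ r → ¬ (voltage (val ρ) (turn ρ) r ≈ voltage (val ρ) (turn ρ) (suc r))
      steps-move ρ r q with step r
      ... | first p = let a , b = p (val ρ) (turn ρ) in
            val≉0 ρ (≈-trans (≡⇒≈ (sym b)) (≈-trans (≈-sym q) (≡⇒≈ a)))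
      ... | up p = let a , b = p (val ρ) (turn ρ) in
            turn≉val ρ (≈-trans (≡⇒≈ (sym b)) (≈-trans (≈-sym q) (≡⇒≈ a)))
      ... | down p = let a , b = p (val ρ) (turn ρ) in
            turn≉val ρ (≈-trans (≡⇒≈ (sym a)) (≈-trans q (≡⇒≈ b)))

      -- As g = n w, the residues 0, ..., w - 1 represent the cosets of the subgroup of order n
      -- generated by `e`.
      digits : ∀ z → ∃[ Q ] ∃[ h ] (Q < n × + Q * e + + toℕ {w} h ≈ z)
      digits z = toℕ (proj₁ Qh) , proj₂ Qh , Fₚ.toℕ<n (proj₁ Qh) , ≈-trans (≡⇒≈ value) (ι-res z)
        where
        x : Fin (n ℕ.* w)
        x = F.cast (sym g≡) (res z)
        Qh : Fin n × Fin w
        Qh = remQuot w x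
        value : + toℕ (proj₁ Qh) * e + + toℕ (proj₂ Qh) ≡ ι (res z)
        value = trans (cong (_+ + toℕ (proj₂ Qh))
                  (trans (ℤₚ.*-comm (+ toℕ (proj₁ Qh)) e) (sym (ℤₚ.pos-* w (toℕ (proj₁ Qh))))))
          (cong +_ (trans (sym (Fₚ.toℕ-combine (proj₁ Qh) (proj₂ Qh)))
            (trans (cong toℕ (Fₚ.combine-remQuot {n} w x)) (Fₚ.toℕ-cast (sym g≡) (res z)))))

      -- τ generates the same subgroup as `e`: if τ = 2e, the coefficient of `e` is halved modulo
      -- the odd number `n`.
      height : ∀ ρ z → ∃[ Q ] ∃[ h ] (Q < n × + Q * turn ρ + + toℕ {w} h ≈ z)
      height ρ z with digits z | turn-view ρ
      ... | Q , h , Q<n , p | single _ t =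
            Q , h , Q<n , ≈-trans (≡⇒≈ (cong (λ t → + Q * t + + toℕ h) t)) p
      ... | q , h , q<n , p | double _ t with halve-mod f q q<n
      ...   | Q , Q<n , inj₁ 2Q≡q = Q , h , Q<n , ≈-trans (≡⇒≈ (trans (cong (λ t → + Q * t + + toℕ h) t)
              (trans (lem (+ Q) e (+ toℕ h)) (cong (λ q → + q * e + + toℕ h) 2Q≡q)))) p
            where lem : ∀ Q e h → Q * (e + e) + h ≡ (Q + Q) * e + h
                  lem = solve-∀
      -- Here 2Q = q + n, and the surplus n e is the modulus.
      ...   | Q , Q<n , inj₂ 2Q≡q = Q , h , Q<n , ≈-trans (≡⇒≈ (trans (cong (λ t → + Q * t + + toℕ h) t)
              (trans (lem (+ Q) e (+ toℕ h)) (cong (λ q → + q * e + + toℕ h) 2Q≡q))))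
              (≈-trans (1ℤ , trans (lem′ (+ q) (+ n) e (+ toℕ h)) (cong (λ t → + q * e + + toℕ h + 1ℤ * t) n*e)) p)
            where lem : ∀ Q e h → Q * (e + e) + h ≡ (Q + Q) * e + h
                  lem = solve-∀
                  lem′ : ∀ q n e h → (q + n) * e + h ≡ q * e + h + 1ℤ * (n * e)
                  lem′ = solve-∀

      n*turn : ∀ ρ → + n * turn ρ ≈ 0ℤ
      n*turn ρ with turn-view ρ
      ... | single _ t = 1ℤ , trans (cong (+ n *_) t) (trans n*e (lem modulus))
            where lem : ∀ M → M ≡ 0ℤ + 1ℤ * M
                  lem = solve-∀
      ... | double _ t = + 2 , trans (cong (+ n *_) t) (trans (ℤₚ.*-distribˡ-+ (+ n) e e) (trans (cong₂ _+_ n*e n*e) (lem modulus)))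
            where lem : ∀ M → M + M ≡ 0ℤ + + 2 * M
                  lem = solve-∀

      -- The height reached from the start `h` after `Q` full turns and `r` further arcs.
      level : Fin g-1 → Fin w → ℕ → ℕ → ℤ
      level ρ h Q r = + Q * turn ρ + voltage (val ρ) (turn ρ) r + + toℕ h

      winding : Fin u → Fin g-1 → Fin s → Fin w → ℕ → ℕ → Vertex u g
      winding i ρ c h Q r = tour i c r , res (level ρ h Q r)

      winding-wrap : ∀ i ρ c h Q → winding i ρ c h Q m ≡ winding i ρ c h (suc Q) 0
      winding-wrap i ρ c h Q = cong₂ _,_ (closed i c) (cong res
        (trans (cong (λ v → + Q * turn ρ + v + + toℕ h) (voltage-even (val ρ) (turn ρ) m-even))
          (lem (+ Q) (turn ρ) (+ toℕ h))))
        where lem : ∀ Q t h → Q * t + t + h ≡ (1ℤ + Q) * t + 0ℤ + h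
              lem = solve-∀

      path : Fin u → Fin g-1 → Fin s → Fin w → ℕ → Vertex u g
      path i ρ c h = spiral m (winding i ρ c h)

      path-at : ∀ i ρ c h {r} Q → r < m → path i ρ c h (r ℕ.+ Q ℕ.* m) ≡ winding i ρ c h Q r
      path-at i ρ c h = spiral-at m (winding i ρ c h)

      path-suc : ∀ i ρ c h {r} Q → r < m → path i ρ c h (suc (r ℕ.+ Q ℕ.* m)) ≡ winding i ρ c h Q (suc r)
      path-suc i ρ c h = spiral-suc m (winding i ρ c h) (winding-wrap i ρ c h)

      -- After `n` turns the height has changed by n τ, which vanishes modulo g.
      path-closed : ∀ i ρ c h → path i ρ c h (n ℕ.* m) ≡ path i ρ c h 0
      path-closed i ρ c h = trans (path-at i ρ c h n 0<m) (trans
        (cong (tour i c 0 ,_) (res-cong (≈-trans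
          (+-cong (+-cong (n*turn ρ) (≈-refl {0ℤ})) (≈-refl {+ toℕ h})) (≡⇒≈ refl))))
        (sym (path-at i ρ c h 0 0<m)))
        where 0<m : 0 < m
              0<m = ℕ.>-nonZero⁻¹ m

      j-split : ∀ j → j ≡ j % m ℕ.+ j / m ℕ.* m
      j-split j = m≡m%n+[m/n]*n j m

      path-adj : ∀ i ρ c h j → Adj (path i ρ c h j) (path i ρ c h (suc j))
      path-adj i ρ c h j = subst (λ j → Adj (path i ρ c h j) (path i ρ c h (suc j))) (sym (j-split j))
        (subst₂ Adj (sym (path-at i ρ c h (j / m) r<m)) (sym (path-suc i ρ c h (j / m) r<m))
          (near-adjacent N (m≥2 m-even) i c (j % m) r<m , λ p → steps-move ρ (j % m)
            (cancel-level (+ (j / m) * turn ρ) (voltage (val ρ) (turn ρ) (j % m)) _ (+ toℕ h) (res≡⇒≈ p))))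
        where
        r<m : j % m < m
        r<m = m%n<n j m
        lem : ∀ Q a h → Q + a + h + - (Q + h) ≡ a
        lem = solve-∀
        cancel-level : ∀ Q a b h → Q + a + h ≈ Q + b + h → a ≈ b
        cancel-level Q a b h p = ≈-trans (≡⇒≈ (sym (lem Q a h)))
          (≈-trans (+-cong p (≈-refl { - (Q + h)})) (≡⇒≈ (lem Q b h)))

      position< : ∀ {r Q} → r < m → Q < n → r ℕ.+ Q ℕ.* m < n ℕ.* m
      position< {r} {Q} r<m Q<n = ℕₚ.≤-trans (ℕₚ.+-monoˡ-< (Q ℕ.* m) r<m) (ℕₚ.*-monoˡ-≤ m Q<n)

      -- Subtracting the partial voltage leaves a residue that `height` splits into full turns and a
      -- starting height.
      reach : ∀ ρ r x → ∃[ h ] ∃[ Q ] (Q < n × level ρ h Q r ≈ ι x)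
      reach ρ r x =
        let a = voltage (val ρ) (turn ρ) r
            Q , h , Q<n , p = height ρ (ι x - a)
        in h , Q , Q<n , ≈-trans (≡⇒≈ (lem (+ Q * turn ρ) a (+ toℕ h)))
             (≈-trans (+-cong (≈-refl {a}) p) (≡⇒≈ (cancel a (ι x))))
        where lem : ∀ Q a h → Q + a + h ≡ a + (Q + h)
              lem = solve-∀

      path-cover : ∀ i ρ v → proj₁ v ≢ i → ∃[ c ] ∃[ h ] ∃[ j ] (j < n ℕ.* m × path i ρ c h j ≡ v)
      path-cover i ρ (a , x) a≢i =
        let c , r , r<m , p = visits i a a≢i
            h , Q , Q<n , q = reach ρ r x
        in c , h , r ℕ.+ Q ℕ.* m , position< r<m Q<n ,
           trans (path-at i ρ c h Q r<m) (cong₂ _,_ p (trans (res-cong q) (res-ι x)))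

      -- The difference y - x selects ρ through `realise`; then `x` selects the starting height and
      -- the turn through `reach`, and the next vertex has to lie at `y`.
      path-arc : ∀ i c r x y → r < m → x ≢ y → ∃[ ρ ] ∃[ h ] ∃[ Q ] (Q < n ×
        path i ρ c h (r ℕ.+ Q ℕ.* m) ≡ (tour i c r , x) × path i ρ c h (suc (r ℕ.+ Q ℕ.* m)) ≡ (tour i c (suc r) , y))
      path-arc i c r x y r<m x≢y =
        let ρ , p = realise r (ι y - ι x) (λ q → x≢y (sym (ι-injective (sub≈0 q))))
            h , Q , Q<n , q = reach ρ r x
            a = voltage (val ρ) (turn ρ) r
            b = voltage (val ρ) (turn ρ) (suc r)
        in ρ , h , Q , Q<n ,
           trans (path-at i ρ c h Q r<m) (cong (tour i c r ,_) (trans (res-cong q) (res-ι x))) ,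
           trans (path-suc i ρ c h Q r<m) (cong (tour i c (suc r) ,_) (trans (res-cong
             (≈-trans (+-cong (+-cong (≈-refl {+ Q * turn ρ}) (≈-sym p)) (≈-refl {+ toℕ h}))
               (≈-trans (≡⇒≈ (lem (+ Q * turn ρ) a (ι y - ι x) (+ toℕ h)))
                 (≈-trans (+-cong q (≈-refl {ι y - ι x})) (≡⇒≈ (cancel (ι x) (ι y))))))) (res-ι y)))
        where lem : ∀ Q a d h → Q + (a + d) + h ≡ Q + a + h + d
              lem = solve-∀

      path-joins : ∀ b v w → Adj v w → ∃[ i ] ∃[ ρ ] ∃[ c ] ∃[ h ] ∃[ j ] (j < n ℕ.* m × hue i c (j % m) ≡ b ×
        Joins (path i ρ c h j) (path i ρ c h (suc j)) v w)
      path-joins b (a , x) (a′ , y) (a≢a′ , x≢y) with joined b a a′ a≢a′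
      ... | i , c , r , r<m , cl , inj₁ (p , q) =
        let ρ , h , Q , Q<n , s , t = path-arc i c r x y r<m x≢y
        in i , ρ , c , h , r ℕ.+ Q ℕ.* m , position< r<m Q<n , trans (cong (hue i c) (mod-at m Q r<m)) cl ,
           inj₁ (trans s (cong (_, x) p) , trans t (cong (_, y) q))
      ... | i , c , r , r<m , cl , inj₂ (p , q) =
        let ρ , h , Q , Q<n , s , t = path-arc i c r y x r<m (x≢y ∘ sym)
        in i , ρ , c , h , r ℕ.+ Q ℕ.* m , position< r<m Q<n , trans (cong (hue i c) (mod-at m Q r<m)) cl ,
           inj₂ (trans s (cong (_, y) p) , trans t (cong (_, x) q))

      -- Factors are indexed by a base vertex and a nonzero ρ, the cycles of a factor by a base
      -- cycle and a starting height.
      lift-cyc : Fin (u ℕ.* g-1) → Fin (s ℕ.* w) → ℕ → Vertex u g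
      lift-cyc φ κ = let i , ρ = remQuot {u} g-1 φ ; c , h = remQuot {s} w κ in path i ρ c h

      lift-rem : Fin (u ℕ.* g-1) → Fin u
      lift-rem φ = proj₁ (remQuot {u} g-1 φ)

      lift-col : Fin (u ℕ.* g-1) → Fin (s ℕ.* w) → ℕ → Bool
      lift-col φ κ j = hue (lift-rem φ) (proj₁ (remQuot {s} w κ)) (j % m)

      lift-cover : ∀ φ v → proj₁ v ≢ lift-rem φ → ∃[ κ ] ∃[ j ] (j < n ℕ.* m × lift-cyc φ κ j ≡ v)
      lift-cover φ v ne = let i , ρ = remQuot {u} g-1 φ ; c , h , j , j<k , p = path-cover i ρ v ne
        in combine c h , j , j<k , trans (cong (λ (c , h) → path i ρ c h j) (Fₚ.remQuot-combine c h)) p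

      lift-edge : ∀ b v w′ → Adj v w′ → ∃[ φ ] ∃[ κ ] ∃[ j ] (j < n ℕ.* m × lift-col φ κ j ≡ b ×
        Joins (lift-cyc φ κ j) (lift-cyc φ κ (suc j)) v w′)
      lift-edge b v w′ vw = let i , ρ , c , h , j , j<k , cl , p = path-joins b v w′ vw
        in combine i ρ , combine c h , j , j<k ,
           subst₂ (λ (i , _) (c , _) → hue i c (j % m) ≡ b)
             (sym (Fₚ.remQuot-combine i ρ)) (sym (Fₚ.remQuot-combine c h)) cl ,
           subst₂ (λ (i , ρ) (c , h) → Joins (path i ρ c h j) (path i ρ c h (suc j)) v w′)
             (sym (Fₚ.remQuot-combine i ρ)) (sym (Fₚ.remQuot-combine c h)) p

    lifted : ARCS (n ℕ.* m) u g 2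
    lifted = CoveringToARCS.arcs (n ℕ.* m) (s ℕ.* m) g-1 (u ℕ.* g-1) (s ℕ.* w)
      lift-cyc lift-rem lift-col
      (λ φ κ → path-closed _ _ _ _) (λ φ κ j _ → path-adj _ _ _ _ j) lift-cover lift-edge refl
      -- Each factor has s w cycles of length n m; with n w = g these are (s m) g positions.
      (trans (lem s w n m) (cong ((s ℕ.* m) ℕ.*_) g≡))
      where lem : ∀ s w n m → (s ℕ.* w) ℕ.* (n ℕ.* m) ≡ (s ℕ.* m) ℕ.* (n ℕ.* w)
            lem = ℕˢ.solve-∀

  -- Relabelling vertices and developing base cycles cyclically.

  transport : ∀ {m s} {U U′ : Set} → U ↔ U′ → NearSystem m s U → NearSystem m s U′
  transport {m} {s} {U} {U′} I N = record
    { tour   = λ i c r → to (N.tour (from i) c r)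
    ; hue    = λ i → N.hue (from i)
    ; closed = λ i c → cong to (N.closed (from i) c)
    ; visits = λ i v v≢i →
        let c , r , r<m , e = N.visits (from i) (from v) (v≢i ∘ from-injective)
        in c , r , r<m , trans (cong to e) (strictlyInverseˡ v)
    ; joined = joined′
    }
    where
    module N = NearSystem N
    open Inverse I
    from-injective : ∀ {x y} → from x ≡ from y → x ≡ y
    from-injective {x} {y} e = trans (sym (strictlyInverseˡ x)) (trans (cong to e) (strictlyInverseˡ y))
    pull : ∀ {a b v w} → Joins a b (from v) (from w) → Joins (to a) (to b) v w
    pull (inj₁ (p , q)) = inj₁ (trans (cong to p) (strictlyInverseˡ _) , trans (cong to q) (strictlyInverseˡ _))
    pull (inj₂ (p , q)) = inj₂ (trans (cong to p) (strictlyInverseˡ _) , trans (cong to q) (strictlyInverseˡ _))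
    joined′ : ∀ b v w → v ≢ w → ∃[ i ] ∃[ c ] ∃[ r ] (r < m × N.hue (from i) c r ≡ b ×
      Joins (to (N.tour (from i) c r)) (to (N.tour (from i) c (suc r))) v w)
    joined′ b v w v≢w with N.joined b (from v) (from w) (v≢w ∘ from-injective)
    ... | i , c , r , r<m , cl , j = to i , c , r , r<m ,
      subst (λ i → N.hue i c r ≡ b) (sym (strictlyInverseʳ i)) cl ,
      subst (λ i → Joins (to (N.tour i c r)) (to (N.tour i c (suc r))) v w) (sym (strictlyInverseʳ i)) (pull j)

  infix 4 _≡±_
  _≡±_ : ℤ → ℤ → Set
  a ≡± b = a ≡ b ⊎ a ≡ - b

  module Symmetric (N : ℕ) where
    open Mod (N ℕ.+ N) public

    infix 4 _≈±_
    _≈±_ : ℤ → ℤ → Set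
    a ≈± b = a ≈ b ⊎ a ≈ - b

    ≈±-neg : ∀ {a b} → a ≈± b → - a ≈± b
    ≈±-neg (inj₁ p) = inj₂ (neg-cong p)
    ≈±-neg (inj₂ p) = inj₁ (≈-trans (neg-cong p) (≡⇒≈ (ℤₚ.neg-involutive _)))

    ≈±-sym : ∀ {a b} → a ≈± b → b ≈± a
    ≈±-sym (inj₁ p) = inj₁ (≈-sym p)
    ≈±-sym {a} {b} (inj₂ p) = inj₂ (≈-trans (≡⇒≈ (sym (ℤₚ.neg-involutive b))) (neg-cong (≈-sym p)))

    ≈±-trans : ∀ {a b c} → a ≈± b → b ≈± c → a ≈± c
    ≈±-trans (inj₁ p) (inj₁ q) = inj₁ (≈-trans p q)
    ≈±-trans (inj₁ p) (inj₂ q) = inj₂ (≈-trans p q)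
    ≈±-trans (inj₂ p) (inj₁ q) = inj₂ (≈-trans p (neg-cong q))
    ≈±-trans {c = c} (inj₂ p) (inj₂ q) = inj₁ (≈-trans p (≈-trans (neg-cong q) (≡⇒≈ (ℤₚ.neg-involutive c))))

    ±-exact : ∀ {a b d} → a ≡± b → b ≈± d → a ≈± d
    ±-exact (inj₁ p) q = ≈±-trans (inj₁ (≡⇒≈ p)) q
    ±-exact (inj₂ p) q = ≈±-trans (inj₂ (≡⇒≈ p)) q

    ±-flip : ∀ a b {d} → b - a ≈± d → a - b ≈± d
    ±-flip a b p = ≈±-trans (inj₁ (≡⇒≈ (lem a b))) (≈±-neg p)
      where lem : ∀ a b → a - b ≡ - (b - a)
            lem = solve-∀

    -- A representative above `N` is replaced by its distance to 2N + 1, at the cost of a sign.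
    absolute : ∀ z → ¬ (z ≈ 0ℤ) → ∃[ d ] (1 ≤ d × d ≤ N × z ≈± + d)
    absolute z z≉0 with res z in eq
    ... | zero = contradiction (≈-trans (≈-sym (ι-res z)) (≡⇒≈ (cong ι eq))) z≉0
    ... | suc x with suc (toℕ x) ℕ.≤? N
    ...   | yes p = suc (toℕ x) , s≤s z≤n , p , inj₁ (≈-trans (≈-sym (ι-res z)) (≡⇒≈ (cong ι eq)))
    ...   | no ¬p = d , ℕₚ.m<n⇒0<n∸m (Fₚ.toℕ<n (F.suc x)) ,
        ℕₚ.m≤n+o⇒m∸n≤o (suc (N ℕ.+ N)) (suc (toℕ x)) (ℕₚ.+-monoˡ-≤ N (ℕₚ.≰⇒> ¬p)) ,
        inj₂ (≈-trans (≈-sym (ι-res z)) (≈-trans (≡⇒≈ (cong ι eq)) (1ℤ , shift)))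
      where
      d : ℕ
      d = suc (N ℕ.+ N) ∸ suc (toℕ x)
      lem : ∀ d x → x ≡ - d + 1ℤ * (d + x)
      lem = solve-∀
      shift : + suc (toℕ x) ≡ - + d + 1ℤ * modulus
      shift = trans (lem (+ d) (+ suc (toℕ x))) (cong (λ t → - + d + 1ℤ * + t) (ℕₚ.m∸n+n≡m (ℕₚ.<⇒≤ (Fₚ.toℕ<n (F.suc x)))))


  module _ {m s : ℕ} (N : ℕ) where

    open Symmetric N

    module _
      (base : Fin s → ℕ → ℤ) (hole : ℤ) (hue : Fin s → ℕ → Bool)
      (closed : ∀ c → base c m ≡ base c 0)
      (visits : ∀ x → x ≤ N ℕ.+ N → ¬ (+ x ≈ hole) → ∃[ c ] ∃[ r ] (r < m × base c r ≈ + x))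
      (differences : ∀ b d → 1 ≤ d → d ≤ N →
         ∃[ c ] ∃[ r ] (r < m × hue c r ≡ b × base c (suc r) - base c r ≈± + d))
      where

      -- Translation by `i - hole` moves the missed residue to `i`. Every edge of difference ±d is a
      -- translate of each base arc with that difference, so one base arc for each colour and each d
      -- from 1 to N suffices.
      cyclic : NearSystem m s (Fin (suc (N ℕ.+ N)))
      cyclic = record
        { tour   = tour
        ; hue    = λ _ → hue
        ; closed = λ i c → cong (λ z → res (z - hole + ι i)) (closed c)
        ; visits = visits′
        ; joined = joined
        }
        where
        tour : Fin (suc (N ℕ.+ N)) → Fin s → ℕ → Fin (suc (N ℕ.+ N))
        tour i c r = res (base c r - hole + ι i)
        visits′ : ∀ i v → v ≢ i → ∃[ c ] ∃[ r ] (r < m × tour i c r ≡ v)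
        visits′ i v v≢i =
          let z = ι v - ι i + hole
              c , r , r<m , p = visits (toℕ (res z)) (ℕ.s≤s⁻¹ (Fₚ.toℕ<n (res z)))
                (λ q → v≢i (ι-injective (≈-trans (≡⇒≈ (lem₁ (ι v) (ι i) hole))
                  (≈-trans (+-cong (≈-trans (≈-sym (ι-res z)) q) (≈-refl {ι i - hole})) (≡⇒≈ (lem₂ (ι i) hole))))))
          in c , r , r<m , trans (res-cong (≈-trans
               (+-cong (+-cong (≈-trans p (ι-res z)) (≈-refl { - hole})) (≈-refl {ι i}))
               (≡⇒≈ (lem₃ (ι v) (ι i) hole)))) (res-ι v)
          where
          lem₁ : ∀ v i h → v ≡ (v - i + h) + (i - h)
          lem₁ = solve-∀
          lem₂ : ∀ i h → h + (i - h) ≡ i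
          lem₂ = solve-∀
          lem₃ : ∀ v i h → v - i + h - h + i ≡ v
          lem₃ = solve-∀
        arc : ∀ c r v w → base c (suc r) - base c r ≈ ι w - ι v →
          ∃[ i ] (tour i c r ≡ v × tour i c (suc r) ≡ w)
        arc c r v w p =
          let z = ι v - base c r + hole in res z ,
          trans (res-cong (≈-trans (+-cong (≈-refl {base c r - hole}) (ι-res z)) (≡⇒≈ (lem₁ (base c r) hole (ι v))))) (res-ι v) ,
          trans (res-cong (≈-trans (+-cong (≈-refl {base c (suc r) - hole}) (ι-res z))
            (≈-trans (≡⇒≈ (lem₂ (base c (suc r)) (base c r) hole (ι v)))
              (≈-trans (+-cong p (≈-refl {ι v})) (≡⇒≈ (lem₃ (ι w) (ι v))))))) (res-ι w)
          where
          lem₁ : ∀ b h v → b - h + (v - b + h) ≡ v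
          lem₁ = solve-∀
          lem₂ : ∀ b′ b h v → b′ - h + (v - b + h) ≡ b′ - b + v
          lem₂ = solve-∀
          lem₃ : ∀ w v → w - v + v ≡ w
          lem₃ = solve-∀
        joined : ∀ b v w → v ≢ w → ∃[ i ] ∃[ c ] ∃[ r ] (r < m × hue c r ≡ b × Joins (tour i c r) (tour i c (suc r)) v w)
        joined b v w v≢w with absolute (ι w - ι v) (λ p → v≢w (sym (ι-injective
          (≈-trans (≡⇒≈ (sym (cancel (ι v) (ι w)))) (≈-trans (+-cong (≈-refl {ι v}) p) (≡⇒≈ (ℤₚ.+-identityʳ (ι v))))))))
        ... | d , 1≤d , d≤N , p with differences b d 1≤d d≤N
        ...   | c , r , r<m , cl , q with ≈±-trans q (≈±-sym p)
        ...     | inj₁ t = let i , x , y = arc c r v w t in i , c , r , r<m , cl , inj₁ (x , y)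
        ...     | inj₂ t = let i , x , y = arc c r w v (≈-trans t (≡⇒≈ (lem (ι w) (ι v)))) in i , c , r , r<m , cl , inj₂ (x , y)
          where lem : ∀ w v → - (w - v) ≡ v - w
                lem = solve-∀


  -- Zigzag paths and the cycles built from them.

  zigzag : ℕ → ℕ → ℕ → ℤ
  zigzag M a 0 = + a
  zigzag M a 1 = + M - + a
  zigzag M a (suc (suc j)) = zigzag M (suc a) j

  zigzag-even : ∀ M a i → zigzag M a (i ℕ.* 2) ≡ + (a ℕ.+ i)
  zigzag-even M a zero = cong +_ (sym (ℕₚ.+-identityʳ a))
  zigzag-even M a (suc i) = trans (zigzag-even M (suc a) i) (cong +_ (sym (ℕₚ.+-suc a i)))

  zigzag-odd : ∀ M a i → zigzag M a (suc (i ℕ.* 2)) ≡ + M - + (a ℕ.+ i)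
  zigzag-odd M a zero = cong (λ a → + M - + a) (sym (ℕₚ.+-identityʳ a))
  zigzag-odd M a (suc i) = trans (zigzag-odd M (suc a) i) (cong (λ a → + M - + a) (sym (ℕₚ.+-suc a i)))

  module Zigzag (M : ℕ) where
    ζ : ℕ → ℤ
    ζ = zigzag M 0

    ζ-shift : ∀ j t → ζ (j ℕ.+ t ℕ.* 2) - ζ j ≡± + t
    ζ-shift j t with halve j
    ... | i , inj₁ refl = inj₁ (trans (cong₂ _-_ (trans (cong ζ (sym (ℕₚ.*-distribʳ-+ 2 i t))) (zigzag-even M 0 (i ℕ.+ t)))
            (zigzag-even M 0 i)) (lem (+ i) (+ t)))
      where lem : ∀ i t → i + t - i ≡ t
            lem = solve-∀
    ... | i , inj₂ refl = inj₂ (trans (cong₂ _-_ (trans (cong (ζ ∘ suc) (sym (ℕₚ.*-distribʳ-+ 2 i t))) (zigzag-odd M 0 (i ℕ.+ t)))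
            (zigzag-odd M 0 i)) (lem (+ M) (+ i) (+ t)))
      where lem : ∀ M i t → M - (i + t) - (M - i) ≡ - t
            lem = solve-∀

    -- Even positions ascend from 0 and odd ones descend from M. An odd distance leads from one half
    -- to the other, so the half-indices add up instead of cancelling as in `ζ-shift`.
    ζ-cross : ∀ j t → ζ (j ℕ.+ suc (t ℕ.* 2)) - ζ j ≡± + M - + j - + t
    ζ-cross j t with halve j
    ... | i , inj₁ refl = inj₁ (trans (cong₂ _-_ (trans (cong ζ (lem₁ i t)) (zigzag-odd M 0 (i ℕ.+ t)))
            (zigzag-even M 0 i)) (trans (lem₂ (+ M) (+ i) (+ t)) (cong (λ x → + M - + x - + t) (lem₃ i))))
      where lem₁ : ∀ i t → i ℕ.* 2 ℕ.+ (1 ℕ.+ t ℕ.* 2) ≡ 1 ℕ.+ (i ℕ.+ t) ℕ.* 2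
            lem₁ = ℕˢ.solve-∀
            lem₂ : ∀ M i t → M - (i + t) - i ≡ M - (i + i) - t
            lem₂ = solve-∀
            lem₃ : ∀ i → i ℕ.+ i ≡ i ℕ.* 2
            lem₃ = ℕˢ.solve-∀
    ... | i , inj₂ refl = inj₂ (trans (cong₂ _-_ (trans (cong ζ (lem₁ i t)) (zigzag-even M 0 (suc (i ℕ.+ t))))
            (zigzag-odd M 0 i)) (trans (lem₂ (+ M) (+ i) (+ t)) (cong (λ x → - (+ M - + x - + t)) (lem₃ i))))
      where lem₁ : ∀ i t → 1 ℕ.+ i ℕ.* 2 ℕ.+ (1 ℕ.+ t ℕ.* 2) ≡ (1 ℕ.+ (i ℕ.+ t)) ℕ.* 2
            lem₁ = ℕˢ.solve-∀
            lem₂ : ∀ M i t → 1ℤ + (i + t) - (M - i) ≡ - (M - (1ℤ + (i + i)) - t)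
            lem₂ = solve-∀
            lem₃ : ∀ i → 1 ℕ.+ (i ℕ.+ i) ≡ 1 ℕ.+ i ℕ.* 2
            lem₃ = ℕˢ.solve-∀

    -- The step lengths M, M - 1, ..., 1 are those of Walecki's zigzag Hamilton path.
    ζ-step : ∀ j → ζ (suc j) - ζ j ≡± + M - + j
    ζ-step j = subst₂ (λ k t → ζ k - ζ j ≡± t) (ℕₚ.+-comm j 1) (ℤₚ.+-identityʳ (+ M - + j)) (ζ-cross j 0)

    ζ-visits : ∀ x → x ≤ M → ∃[ j ] (j ≤ M × ζ j ≡ + x)
    ζ-visits x x≤M with x ℕ.* 2 ℕ.≤? M
    ... | yes p = x ℕ.* 2 , p , zigzag-even M 0 x
    -- A value above M / 2 lies on the descending half, at position 2(M - x) + 1, which is at most M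
    -- because 2x > M.
    ... | no ¬p = suc (y ℕ.* 2) , ℕₚ.+-cancelʳ-≤ (x ℕ.+ x) _ _ bound ,
          trans (zigzag-odd M 0 y) (trans (cong (λ M → + M - + y) (sym y+x)) (lem₂ (+ y) (+ x)))
      where
      y : ℕ
      y = M ∸ x
      y+x : y ℕ.+ x ≡ M
      y+x = ℕₚ.m∸n+n≡m x≤M
      lem₁ : ∀ y x → suc (y ℕ.* 2) ℕ.+ (x ℕ.+ x) ≡ (y ℕ.+ x) ℕ.+ suc (y ℕ.+ x)
      lem₁ = ℕˢ.solve-∀
      lem₂ : ∀ y x → y + x - y ≡ x
      lem₂ = solve-∀
      lem₃ : ∀ x → x ℕ.* 2 ≡ x ℕ.+ x
      lem₃ = ℕˢ.solve-∀
      bound : suc (y ℕ.* 2) ℕ.+ (x ℕ.+ x) ≤ M ℕ.+ (x ℕ.+ x)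
      bound = ℕₚ.≤-trans (ℕₚ.≤-reflexive (trans (lem₁ y x) (cong (λ M → M ℕ.+ suc M) y+x)))
        (ℕₚ.+-monoʳ-≤ M (subst (M <_) (lem₃ x) (ℕₚ.≰⇒> ¬p)))

  below-or-above : ∀ h a → a < h ⊎ ∃[ b ] a ≡ h ℕ.+ b
  below-or-above h a with a ℕ.<? h
  ... | yes p = inj₁ p
  ... | no ¬p = inj₂ (a ∸ h , sym (ℕₚ.m+[n∸m]≡n (ℕₚ.≮⇒≥ ¬p)))

  -- The closed walk A 0, …, A (h-1), B (h-1), …, B 0.
  module Ladder (h-1 : ℕ) (A B : ℕ → ℤ) (front back bottom : Bool) where
    private
      h : ℕ
      h = suc h-1

    ladder : ℕ → ℤ
    ladder r = if does (r ℕ.<? h) then A r else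
               if does (r ℕ.<? h ℕ.+ h) then B (h ℕ.+ h ∸ suc r) else A 0

    -- The top rung, at position `h-1`, counts with the front; only the closing rung has a separate
    -- colour.
    shade : ℕ → Bool
    shade r = if does (r ℕ.<? h) then front else if does (suc r ℕ.<? h ℕ.+ h) then back else bottom

    ladder-front : ∀ {j} → j < h → ladder j ≡ A j
    ladder-front {j} j<h rewrite dec-true (j ℕ.<? h) j<h = refl

    -- `B` is traversed downwards; the hypothesis says j = h - 1 - t without truncated subtraction.
    ladder-back : ∀ t j → t ℕ.+ suc j ≡ h → ladder (h ℕ.+ t) ≡ B j
    ladder-back t j e
      rewrite dec-false (h ℕ.+ t ℕ.<? h) (ℕₚ.≤⇒≯ (ℕₚ.m≤m+n h t))
            | dec-true (h ℕ.+ t ℕ.<? h ℕ.+ h) (ℕₚ.+-monoʳ-< h (subst (t <_) e (ℕₚ.m<m+n t (s≤s z≤n))))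
      = cong B (trans (cong (λ x → h ℕ.+ x ∸ suc (h ℕ.+ t)) (sym e)) (trans (cong (_∸ suc (h ℕ.+ t)) (lem h t j)) (ℕₚ.m+n∸m≡n (suc (h ℕ.+ t)) j)))
      where lem : ∀ h t j → h ℕ.+ (t ℕ.+ (1 ℕ.+ j)) ≡ 1 ℕ.+ (h ℕ.+ t) ℕ.+ j
            lem = ℕˢ.solve-∀

    ladder-end : ladder (h ℕ.+ h) ≡ A 0
    ladder-end rewrite dec-false (h ℕ.+ h ℕ.<? h) (ℕₚ.≤⇒≯ (ℕₚ.m≤m+n h h))
                     | dec-false (h ℕ.+ h ℕ.<? h ℕ.+ h) (ℕₚ.n≮n (h ℕ.+ h)) = refl

    ladder-closed : ladder (h ℕ.+ h) ≡ ladder 0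
    ladder-closed = trans ladder-end (sym (ladder-front (s≤s z≤n)))

    shade-front : ∀ {r} → r < h → shade r ≡ front
    shade-front {r} r<h rewrite dec-true (r ℕ.<? h) r<h = refl

    shade-back : ∀ t → suc t < h → shade (h ℕ.+ t) ≡ back
    shade-back t t<h rewrite dec-false (h ℕ.+ t ℕ.<? h) (ℕₚ.≤⇒≯ (ℕₚ.m≤m+n h t))
      | dec-true (suc (h ℕ.+ t) ℕ.<? h ℕ.+ h) (subst (_< h ℕ.+ h) (ℕₚ.+-suc h t) (ℕₚ.+-monoʳ-< h t<h)) = refl

    shade-bottom : shade (h ℕ.+ h-1) ≡ bottom
    shade-bottom rewrite dec-false (h ℕ.+ h-1 ℕ.<? h) (ℕₚ.≤⇒≯ (ℕₚ.m≤m+n h h-1))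
      | dec-false (suc (h ℕ.+ h-1) ℕ.<? h ℕ.+ h) (λ p → ℕₚ.n≮n (h ℕ.+ h) (subst (_< h ℕ.+ h) (sym (ℕₚ.+-suc h h-1)) p)) = refl

    Visit : ℤ → Set
    Visit x = ∃[ r ] (r < h ℕ.+ h × ladder r ≡ x)

    visit-front : ∀ {j} → j < h → Visit (A j)
    visit-front {j} j<h = j , ℕₚ.<-≤-trans j<h (ℕₚ.m≤m+n h h) , ladder-front j<h

    visit-back : ∀ {j} → j < h → Visit (B j)
    visit-back {j} j<h = h ℕ.+ t , ℕₚ.+-monoʳ-< h (subst (t <_) e (ℕₚ.m<m+n t (s≤s z≤n))) , ladder-back t j e
      where t = h ∸ suc j
            e : t ℕ.+ suc j ≡ h
            e = ℕₚ.m∸n+n≡m j<h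

    Arc : Bool → ℤ → Set
    Arc b δ = ∃[ r ] (r < h ℕ.+ h × shade r ≡ b × ladder (suc r) - ladder r ≡ δ)

    arc-front : ∀ {j} → suc j < h → Arc front (A (suc j) - A j)
    arc-front {j} j<h = j , ℕₚ.<-≤-trans (ℕₚ.<⇒≤ j<h) (ℕₚ.m≤m+n h h) , shade-front (ℕₚ.<⇒≤ j<h) ,
      cong₂ _-_ (ladder-front j<h) (ladder-front (ℕₚ.<⇒≤ j<h))

    arc-top : Arc front (B h-1 - A h-1)
    arc-top = h-1 , ℕₚ.m≤m+n h h , shade-front ℕₚ.≤-refl ,
      cong₂ _-_ (trans (cong ladder (sym (ℕₚ.+-identityʳ h))) (ladder-back 0 h-1 refl)) (ladder-front ℕₚ.≤-refl)

    arc-back : ∀ {j} → suc j < h → Arc back (B j - B (suc j))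
    arc-back {j} j<h = h ℕ.+ t , ℕₚ.+-monoʳ-< h (ℕₚ.<⇒≤ t<h) , shade-back t t<h ,
      cong₂ _-_ (trans (cong ladder (sym (ℕₚ.+-suc h t))) (ladder-back (suc t) j (trans (sym (ℕₚ.+-suc t (suc j))) e)))
                (ladder-back t (suc j) e)
      where t = h ∸ suc (suc j)
            e : t ℕ.+ suc (suc j) ≡ h
            e = ℕₚ.m∸n+n≡m j<h
            t<h : suc t < h
            t<h = subst (suc t <_) e (subst (suc t <_) (sym (ℕₚ.+-suc t (suc j))) (s≤s (ℕₚ.m<m+n t (s≤s z≤n))))

    arc-bottom : Arc bottom (A 0 - B 0)
    arc-bottom = h ℕ.+ h-1 , ℕₚ.+-monoʳ-< h ℕₚ.≤-refl , shade-bottom ,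
      cong₂ _-_ (trans (cong ladder (sym (ℕₚ.+-suc h h-1))) ladder-end) (ladder-back h-1 0 (ℕₚ.+-comm h-1 1))

  -- A zigzag path on h consecutive residues followed by its translate by h.
  oneCycle : ∀ h-1 → NearSystem (suc h-1 ℕ.+ suc h-1) 1 (Fin (suc (suc h-1 ℕ.+ suc h-1)))
  oneCycle h-1 = cyclic h (λ _ → ladder) (+ (h ℕ.+ h)) (λ _ → shade) (λ _ → ladder-closed) visits differences
    where
    h : ℕ
    h = suc h-1
    open Symmetric h
    open Zigzag h-1

    raised : ℕ → ℤ
    raised j = + h + ζ j

    open Ladder h-1 ζ raised false true true

    visits : ∀ x → x ≤ h ℕ.+ h → ¬ (+ x ≈ + (h ℕ.+ h)) → ∃ λ (c : Fin 1) → ∃[ r ] (r < h ℕ.+ h × ladder r ≈ + x)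
    visits x x≤2h x≉2h with below-or-above h x
    ... | inj₁ x<h = let j , j≤ , p = ζ-visits x (ℕ.s≤s⁻¹ x<h)
                         r , r< , q = visit-front (s≤s j≤)
                     in zero , r , r< , ≡⇒≈ (trans q p)
    ... | inj₂ (y , refl) with ℕₚ.m≤n⇒m<n∨m≡n (ℕₚ.+-cancelˡ-≤ h y h x≤2h)
    ...   | inj₂ refl = contradiction ≈-refl x≉2h
    ...   | inj₁ y<h = let j , j≤ , p = ζ-visits y (ℕ.s≤s⁻¹ y<h)
                           r , r< , q = visit-back (s≤s j≤)
                       in zero , r , r< , ≡⇒≈ (trans q (cong (λ y → + h + y) p))

    Found : Bool → ℕ → Set
    Found b d = ∃ λ (c : Fin 1) → ∃[ r ] (r < h ℕ.+ h × shade r ≡ b × ladder (suc r) - ladder r ≈± + d)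

    found : ∀ {b δ} d → Arc b δ → δ ≈± + d → Found b d
    found d (r , r< , cl , e) p = zero , r , r< , cl , ≈±-trans (inj₁ (≡⇒≈ e)) p

    -- The difference `h` comes from the two rungs, one in each colour; a smaller one from a step of
    -- the zigzag and from the same step of its translate.
    differences : ∀ b d → 1 ≤ d → d ≤ h → Found b d
    differences b d 1≤d d≤h with ℕₚ.m≤n⇒m<n∨m≡n d≤h
    differences false d 1≤d d≤h | inj₂ refl = found d arc-top (inj₁ (≡⇒≈ (lem (+ h) (ζ h-1))))
      where lem : ∀ h z → h + z - z ≡ h
            lem = solve-∀
    differences true d 1≤d d≤h | inj₂ refl = found d arc-bottom (inj₂ (≡⇒≈ (lem (+ h) (ζ 0))))
      where lem : ∀ h z → z - (h + z) ≡ - h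
            lem = solve-∀
    differences b (suc d-1) (s≤s _) _ | inj₁ (s≤s d≤h-1) = pick b
      where
      d j : ℕ
      d = suc d-1
      -- Step `j` of the zigzag has length h - 1 - j, so this is the step of length `d`.
      j = h-1 ∸ d
      d+j : d ℕ.+ j ≡ h-1
      d+j = ℕₚ.m+[n∸m]≡n d≤h-1
      j<h : suc j < h
      j<h = s≤s (subst (j <_) d+j (ℕₚ.m<n+m j (s≤s z≤n)))
      lem : ∀ d j → d + j - j ≡ d
      lem = solve-∀
      size : ζ (suc j) - ζ j ≈± + d
      size = ±-exact (ζ-step j) (inj₁ (≡⇒≈ (trans (cong (λ M → + M - + j) (sym d+j)) (lem (+ d) (+ j)))))
      lem′ : ∀ h a b → h + a - (h + b) ≡ a - b
      lem′ = solve-∀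
      pick : ∀ b → Found b d
      pick false = found d (arc-front j<h) size
      pick true  = found d (arc-back j<h) (≈±-trans (inj₁ (≡⇒≈ (lem′ (+ h) (ζ j) (ζ (suc j))))) (±-flip (ζ j) (ζ (suc j)) size))

  -- Deleting vertex h of the zigzag through ℤ_{4h+1} leaves four segments of length h; the first is
  -- joined to the third and the second to the fourth.  The joining edges have the differences
  -- ±(h + 1), ±2h, ±h, ±h that the deleted links leave uncovered.
  twoCycles : ∀ h-1 → NearSystem (suc h-1 ℕ.+ suc h-1) 2 (Fin (suc ((suc h-1 ℕ.+ suc h-1) ℕ.+ (suc h-1 ℕ.+ suc h-1))))
  twoCycles h-1 = cyclic N base (ζ h) hue base-closed visits differences
    where
    h N M : ℕ
    h = suc h-1
    N = h ℕ.+ h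
    M = N ℕ.+ N
    open Symmetric N
    open Zigzag M

    B₀ A₁ B₁ : ℕ → ℤ
    B₀ j = ζ (suc (N ℕ.+ j))
    A₁ j = ζ (suc (h ℕ.+ j))
    B₁ j = ζ (suc (N ℕ.+ h ℕ.+ j))

    module C₀ = Ladder h-1 ζ B₀ false false true
    module C₁ = Ladder h-1 A₁ B₁ true true false

    base : Fin 2 → ℕ → ℤ
    base zero    = C₀.ladder
    base (suc _) = C₁.ladder

    hue : Fin 2 → ℕ → Bool
    hue zero    = C₀.shade
    hue (suc _) = C₁.shade

    base-closed : ∀ c → base c N ≡ base c 0
    base-closed zero    = C₀.ladder-closed
    base-closed (suc _) = C₁.ladder-closed

    visit₀ : ∀ {x y} → C₀.Visit x → x ≡ y → ∃[ c ] ∃[ r ] (r < N × base c r ≈ y)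
    visit₀ (r , r< , p) q = zero , r , r< , ≡⇒≈ (trans p q)

    visit₁ : ∀ {x y} → C₁.Visit x → x ≡ y → ∃[ c ] ∃[ r ] (r < N × base c r ≈ y)
    visit₁ (r , r< , p) q = suc zero , r , r< , ≡⇒≈ (trans p q)

    -- Positions 0, ..., h - 1 and 2h + 1, ..., 3h of the zigzag form the first cycle, h + 1, ...,
    -- 2h and 3h + 1, ..., 4h the second; position `h` is the hole.
    locate : ∀ α x → α ≤ M → ζ α ≡ + x → ¬ (+ x ≈ ζ h) → ∃[ c ] ∃[ r ] (r < N × base c r ≈ + x)
    locate α x α≤M p x≉ with below-or-above h α
    ... | inj₁ α<h = visit₀ (C₀.visit-front α<h) p
    ... | inj₂ (zero , refl) = contradiction (≡⇒≈ (trans (sym p) (cong ζ (ℕₚ.+-identityʳ h)))) x≉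
    ... | inj₂ (suc β , refl) with below-or-above h β
    ...   | inj₁ β<h = visit₁ (C₁.visit-front β<h) (trans (cong ζ (sym (ℕₚ.+-suc h β))) p)
    ...   | inj₂ (γ , refl) with below-or-above h γ
    ...     | inj₁ γ<h = visit₀ (C₀.visit-back γ<h) (trans (cong ζ (lem h γ)) p)
      where lem : ∀ h γ → 1 ℕ.+ (h ℕ.+ h ℕ.+ γ) ≡ h ℕ.+ (1 ℕ.+ (h ℕ.+ γ))
            lem = ℕˢ.solve-∀
    ...     | inj₂ (δ , refl) = visit₁ (C₁.visit-back (ℕₚ.+-cancelˡ-≤ (h ℕ.+ h ℕ.+ h) (suc δ) h
                (ℕₚ.≤-trans (ℕₚ.≤-reflexive (lem₁ h δ)) (ℕₚ.≤-trans α≤M (ℕₚ.≤-reflexive (lem₂ h)))))) (trans (cong ζ (lem h δ)) p)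
      where lem : ∀ h δ → 1 ℕ.+ (h ℕ.+ h ℕ.+ h ℕ.+ δ) ≡ h ℕ.+ (1 ℕ.+ (h ℕ.+ (h ℕ.+ δ)))
            lem = ℕˢ.solve-∀
            lem₁ : ∀ h δ → h ℕ.+ h ℕ.+ h ℕ.+ (1 ℕ.+ δ) ≡ h ℕ.+ (1 ℕ.+ (h ℕ.+ (h ℕ.+ δ)))
            lem₁ = ℕˢ.solve-∀
            lem₂ : ∀ h → (h ℕ.+ h) ℕ.+ (h ℕ.+ h) ≡ h ℕ.+ h ℕ.+ h ℕ.+ h
            lem₂ = ℕˢ.solve-∀

    visits : ∀ x → x ≤ M → ¬ (+ x ≈ ζ h) → ∃[ c ] ∃[ r ] (r < N × base c r ≈ + x)
    visits x x≤M = let α , α≤M , p = ζ-visits x x≤M in locate α x α≤M p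

    Found : Bool → ℕ → Set
    Found b d = ∃[ c ] ∃[ r ] (r < N × hue c r ≡ b × base c (suc r) - base c r ≈± + d)

    found₀ : ∀ {b δ} d → C₀.Arc b δ → δ ≈± + d → Found b d
    found₀ d (r , r< , cl , e) p = zero , r , r< , cl , ≈±-trans (inj₁ (≡⇒≈ e)) p

    found₁ : ∀ {b δ} d → C₁.Arc b δ → δ ≈± + d → Found b d
    found₁ d (r , r< , cl , e) p = suc zero , r , r< , cl , ≈±-trans (inj₁ (≡⇒≈ e)) p

    wraps : ∀ {z d} → z + + d ≡ modulus → z ≈± + d
    wraps {z} {d} p = inj₂ (1ℤ , trans (lem z (+ d)) (cong (λ t → - + d + 1ℤ * t) p))
      where lem : ∀ z d → z ≡ - d + 1ℤ * (z + d)
            lem = solve-∀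

    step-exact : ∀ j d → j ℕ.+ d ≡ M → ζ (suc j) - ζ j ≈± + d
    step-exact j d p = ±-exact (ζ-step j) (inj₁ (≡⇒≈ (trans (cong (λ M → + M - + j) (sym p)) (lem (+ j) (+ d)))))
      where lem : ∀ j d → j + d - j ≡ d
            lem = solve-∀

    -- The step length 4h - j is -(j + 1) modulo 4h + 1, so early steps of the zigzag realise small
    -- differences.
    step-wraps : ∀ j → ζ (suc j) - ζ j ≈± + suc j
    step-wraps j = ±-exact (ζ-step j) (wraps (lem (+ M) (+ j)))
      where lem : ∀ M j → M - j + (1ℤ + j) ≡ 1ℤ + M
            lem = solve-∀

    cross-wraps : ∀ j t → ζ (j ℕ.+ suc (t ℕ.* 2)) - ζ j ≈± + suc (j ℕ.+ t)
    cross-wraps j t = ±-exact (ζ-cross j t) (wraps (lem (+ M) (+ j) (+ t)))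
      where lem : ∀ M j t → M - j - t + (1ℤ + (j + t)) ≡ 1ℤ + M
            lem = solve-∀

    shift-exact : ∀ j t → ζ (j ℕ.+ t ℕ.* 2) - ζ j ≈± + t
    shift-exact j t = ±-exact (ζ-shift j t) (inj₁ ≈-refl)

    -- Colour `false`: 1, ..., h - 1 and h + 1, ..., 2h - 1 on the two sides of the first ladder, 2h
    -- on its top rung, h on the bottom rung of the second. Colour `true`: h + 2, ..., 2h and 1,
    -- ..., h - 1 on the sides of the second, h on its top rung, h + 1 on the bottom rung of the
    -- first.
    differences : ∀ b d → 1 ≤ d → d ≤ N → Found b d
    differences b (suc j) _ d≤N with below-or-above h (suc j)
    differences false (suc j) _ d≤N | inj₁ j<h = found₀ (suc j) (C₀.arc-front j<h) (step-wraps j)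
    differences true (suc j) _ d≤N | inj₁ j<h = found₁ (suc j) (C₁.arc-back i<h)
      (±-flip (ζ (suc (N ℕ.+ h ℕ.+ i))) _ (subst (λ k → ζ (suc k) - ζ (suc (N ℕ.+ h ℕ.+ i)) ≈± + suc j) (sym (ℕₚ.+-suc (N ℕ.+ h) i))
        (step-exact (suc (N ℕ.+ h ℕ.+ i)) (suc j) (trans (lem h i j) (cong (λ x → (h ℕ.+ h) ℕ.+ (h ℕ.+ x)) e)))))
      where
      i : ℕ
      i = h ∸ suc (suc j)
      e : i ℕ.+ suc (suc j) ≡ h
      e = ℕₚ.m∸n+n≡m j<h
      i<h : suc i < h
      i<h = subst (suc i <_) (trans (lem′ i j) e) (ℕₚ.m<m+n (suc i) (s≤s z≤n))
        where lem′ : ∀ i j → 1 ℕ.+ i ℕ.+ (1 ℕ.+ j) ≡ i ℕ.+ (1 ℕ.+ (1 ℕ.+ j))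
              lem′ = ℕˢ.solve-∀
      lem : ∀ h i j → 1 ℕ.+ (h ℕ.+ h ℕ.+ h ℕ.+ i) ℕ.+ (1 ℕ.+ j) ≡ (h ℕ.+ h) ℕ.+ (h ℕ.+ (i ℕ.+ (1 ℕ.+ (1 ℕ.+ j))))
      lem = ℕˢ.solve-∀
    differences b (suc j) _ d≤N | inj₂ (zero , e) = subst (Found b) (trans (sym (ℕₚ.+-identityʳ h)) (sym e)) (at-h b)
      where
      lem₁ : ∀ h → 1 ℕ.+ (h ℕ.+ 0) ℕ.+ h ℕ.* 2 ≡ 1 ℕ.+ (h ℕ.+ h ℕ.+ h ℕ.+ 0)
      lem₁ = ℕˢ.solve-∀
      lem₂ : ∀ h i → 1 ℕ.+ (h ℕ.+ i) ℕ.+ h ℕ.* 2 ≡ 1 ℕ.+ (h ℕ.+ h ℕ.+ h ℕ.+ i)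
      lem₂ = ℕˢ.solve-∀
      at-h : ∀ b → Found b h
      at-h false = found₁ h C₁.arc-bottom (±-flip (ζ (suc (h ℕ.+ 0))) _ (subst (λ k → ζ k - ζ (suc (h ℕ.+ 0)) ≈± + h) (lem₁ h) (shift-exact (suc (h ℕ.+ 0)) h)))
      at-h true  = found₁ h C₁.arc-top (subst (λ k → ζ k - ζ (suc (h ℕ.+ h-1)) ≈± + h) (lem₂ h h-1) (shift-exact (suc (h ℕ.+ h-1)) h))
    differences false (suc j) _ d≤N | inj₂ (suc ε , e) with ℕₚ.m≤n⇒m<n∨m≡n (ℕₚ.+-cancelˡ-≤ h (suc ε) h (subst (_≤ N) e d≤N))
    ... | inj₂ refl = subst (Found false) (sym e) (found₀ N C₀.arc-top
      (subst (λ k → ζ k - ζ h-1 ≈± + N) (lem h-1) (cross-wraps h-1 h)))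
      where lem : ∀ x → x ℕ.+ (1 ℕ.+ (1 ℕ.+ x) ℕ.* 2) ≡ 1 ℕ.+ ((1 ℕ.+ x) ℕ.+ (1 ℕ.+ x) ℕ.+ x)
            lem = ℕˢ.solve-∀
    ... | inj₁ ε<h = subst (Found false) (sym e) (found₀ (h ℕ.+ suc ε) (C₀.arc-back i<h)
      (±-flip (ζ (suc (N ℕ.+ i))) _ (subst (λ k → ζ (suc k) - ζ (suc (N ℕ.+ i)) ≈± + (h ℕ.+ suc ε)) (sym (ℕₚ.+-suc N i))
        (step-exact (suc (N ℕ.+ i)) (h ℕ.+ suc ε) (trans (lem h i ε) (cong (λ x → (h ℕ.+ h) ℕ.+ (h ℕ.+ x)) q))))))
      where
      i : ℕ
      i = h ∸ suc (suc ε)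
      q : i ℕ.+ suc (suc ε) ≡ h
      q = ℕₚ.m∸n+n≡m ε<h
      i<h : suc i < h
      i<h = subst (suc i <_) (trans (lem′ i ε) q) (ℕₚ.m<m+n (suc i) (s≤s z≤n))
        where lem′ : ∀ i j → 1 ℕ.+ i ℕ.+ (1 ℕ.+ j) ≡ i ℕ.+ (1 ℕ.+ (1 ℕ.+ j))
              lem′ = ℕˢ.solve-∀
      lem : ∀ h i j → 1 ℕ.+ (h ℕ.+ h ℕ.+ i) ℕ.+ (h ℕ.+ (1 ℕ.+ j)) ≡ (h ℕ.+ h) ℕ.+ (h ℕ.+ (i ℕ.+ (1 ℕ.+ (1 ℕ.+ j))))
      lem = ℕˢ.solve-∀
    differences true (suc j) _ d≤N | inj₂ (suc zero , e) = subst (Found true) (sym e) (found₀ (h ℕ.+ 1) C₀.arc-bottom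
      (±-flip (ζ 0) (ζ (suc (N ℕ.+ 0))) (subst₂ (λ k d → ζ k - ζ 0 ≈± + d) (lem h) (ℕₚ.+-comm 1 h) (cross-wraps 0 h))))
      where lem : ∀ h → 0 ℕ.+ (1 ℕ.+ h ℕ.* 2) ≡ 1 ℕ.+ (h ℕ.+ h ℕ.+ 0)
            lem = ℕˢ.solve-∀
    differences true (suc j) _ d≤N | inj₂ (suc (suc ε) , e) = subst (Found true) (sym e) (found₁ (h ℕ.+ suc (suc ε))
      (C₁.arc-front (ℕₚ.+-cancelˡ-≤ h (suc (suc ε)) h (subst (_≤ N) e d≤N)))
      (subst₂ (λ k d → ζ (suc k) - ζ (suc (h ℕ.+ ε)) ≈± + d) (sym (ℕₚ.+-suc h ε)) (lem h ε) (step-wraps (suc (h ℕ.+ ε)))))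
      where lem : ∀ h ε → 1 ℕ.+ (1 ℕ.+ (h ℕ.+ ε)) ≡ h ℕ.+ (1 ℕ.+ (1 ℕ.+ ε))
            lem = ℕˢ.solve-∀

  -- One-frames and blowing up their blocks.

  Block : ℕ → Set
  Block s = Fin s × Bool

  -- Blocks with the same first component form a group; pairs i matches the blocks outside the
  -- group of i.
  record Frame (s-1 : ℕ) : Set where
    field
      pairs   : Block (suc s-1) → Fin s-1 → Block (suc s-1) × Block (suc s-1)
      matched : ∀ i b → proj₁ b ≢ proj₁ i → ∃[ c ] (proj₁ (pairs i c) ≡ b ⊎ proj₂ (pairs i c) ≡ b)
      paired  : ∀ b b′ → proj₁ b ≢ proj₁ b′ →
                  ∃[ i ] ∃[ c ] Joins (proj₁ (pairs i c)) (proj₂ (pairs i c)) b b′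

  parity : ℕ → Bool
  parity zero    = false
  parity (suc n) = not (parity n)

  parity-even : ∀ k → parity (k ℕ.* 2) ≡ false
  parity-even zero    = refl
  parity-even (suc k) = trans (Bₚ.not-involutive _) (parity-even k)

  parity-odd : ∀ k → parity (suc (k ℕ.* 2)) ≡ true
  parity-odd k = cong not (parity-even k)

  module BlowUp {s-1 h-1 : ℕ} (F : Frame s-1)
    (K : NearSystem (suc h-1 ℕ.* 2) 1 (Maybe (Bool × Fin (suc h-1)))) where

    open Frame F
    open Mod h-1
    private
      module K = NearSystem K
      s h : ℕ
      s = suc s-1
      h = suc h-1

      Point : Set
      Point = Maybe (Block s × Fin h)

      -- The 2h points of each group, together with the common point `nothing`, carry a copy of `K`.
      embed : Fin s → Maybe (Bool × Fin h) → Point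
      embed p nothing        = nothing
      embed p (just (ε , x)) = just ((p , ε) , x)

      -- A Hamilton cycle of K_{h,h}. The index in `b′` exceeds that in `b` by `x` on arcs leaving
      -- `b` and by x - 1 on arcs returning to it. As `x` runs over ℤ_h, each edge thus occurs once
      -- at an even and once at an odd position.
      weave : Block s → Block s → Fin h → ℕ → ℕ → Point
      weave b b′ x q 0 = just (b , res (+ q))
      weave b b′ x q 1 = just (b′ , res (+ q + ι x))
      weave b b′ x q (suc (suc r)) = weave b b′ x (suc q) r

      weave-even : ∀ b b′ x q k → weave b b′ x q (k ℕ.* 2) ≡ just (b , res (+ (q ℕ.+ k)))
      weave-even b b′ x q zero = cong (λ q → just (b , res (+ q))) (sym (ℕₚ.+-identityʳ q))
      weave-even b b′ x q (suc k) = trans (weave-even b b′ x (suc q) k)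
        (cong (λ q → just (b , res (+ q))) (sym (ℕₚ.+-suc q k)))

      weave-odd : ∀ b b′ x q k → weave b b′ x q (suc (k ℕ.* 2)) ≡ just (b′ , res (+ (q ℕ.+ k) + ι x))
      weave-odd b b′ x q zero = cong (λ q → just (b′ , res (+ q + ι x))) (sym (ℕₚ.+-identityʳ q))
      weave-odd b b′ x q (suc k) = trans (weave-odd b b′ x (suc q) k)
        (cong (λ q → just (b′ , res (+ q + ι x))) (sym (ℕₚ.+-suc q k)))

      weave-closed : ∀ b b′ x → weave b b′ x 0 (h ℕ.* 2) ≡ weave b b′ x 0 0
      weave-closed b b′ x = trans (weave-even b b′ x 0 h)
        (cong (λ y → just (b , y)) (res-cong {modulus} {0ℤ} (1ℤ , lem modulus)))
        where lem : ∀ M → M ≡ 0ℤ + 1ℤ * M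
              lem = solve-∀

      weave-left : ∀ b b′ x y → weave b b′ x 0 (toℕ y ℕ.* 2) ≡ just (b , y)
      weave-left b b′ x y = trans (weave-even b b′ x 0 (toℕ y)) (cong (λ y → just (b , y)) (res-ι y))

      weave-right : ∀ b b′ x y → ∃[ k ] (k < h × weave b b′ x 0 (suc (k ℕ.* 2)) ≡ just (b′ , y))
      weave-right b b′ x y = toℕ z , Fₚ.toℕ<n z , trans (weave-odd b b′ x 0 (toℕ z))
        (cong (λ y → just (b′ , y)) (trans (res-cong (≈-trans (+-cong (ι-res (ι y - ι x)) (≈-refl {ι x})) (≡⇒≈ (lem (ι y) (ι x))))) (res-ι y)))
        where z = res (ι y - ι x)
              lem : ∀ y x → y - x + x ≡ y
              lem = solve-∀

      even< : ∀ {k} → k < h → k ℕ.* 2 < h ℕ.* 2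
      even< = ℕₚ.*-monoˡ-< 2

      odd< : ∀ {k} → k < h → suc (k ℕ.* 2) < h ℕ.* 2
      odd< k<h = ℕₚ.*-monoˡ-≤ 2 k<h

      -- Even positions carry the arcs from b to b′, odd positions those from b′ to b.
      weave-arc : ∀ t b b′ y y′ → ∃[ x ] ∃[ r ] (r < h ℕ.* 2 × parity r ≡ t ×
        Joins (weave b b′ x 0 r) (weave b b′ x 0 (suc r)) (just (b , y)) (just (b′ , y′)))
      weave-arc false b b′ y y′ = x , toℕ y ℕ.* 2 , even< (Fₚ.toℕ<n y) , parity-even (toℕ y) , inj₁
        (weave-left b b′ x y , trans (weave-odd b b′ x 0 (toℕ y)) (cong (λ y → just (b′ , y))
          (trans (res-cong (≈-trans (+-cong (≈-refl {ι y}) (ι-res (ι y′ - ι y))) (≡⇒≈ (cancel (ι y) (ι y′))))) (res-ι y′))))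
        where x = res (ι y′ - ι y)
      weave-arc true b b′ y y′ = x , suc (toℕ q ℕ.* 2) , odd< (Fₚ.toℕ<n q) , parity-odd (toℕ q) , inj₂
        (trans (weave-odd b b′ x 0 (toℕ q)) (cong (λ y → just (b′ , y))
           (trans (res-cong (≈-trans (+-cong (ι-res (ι y - 1ℤ)) (ι-res (ι y′ - ι y + 1ℤ))) (≡⇒≈ (lem₁ (ι y) (ι y′))))) (res-ι y′))) ,
         trans (weave-even b b′ x 1 (toℕ q)) (cong (λ y → just (b , y))
           (trans (res-cong (≈-trans (+-cong (≈-refl {1ℤ}) (ι-res (ι y - 1ℤ))) (≡⇒≈ (cancel 1ℤ (ι y))))) (res-ι y))))
        where
        q = res (ι y - 1ℤ)
        x = res (ι y′ - ι y + 1ℤ)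
        lem₁ : ∀ y y′ → y - 1ℤ + (y′ - y + 1ℤ) ≡ y′
        lem₁ = solve-∀

      -- For the hole `nothing` there is one cycle per group. For a point of block `i`, cycle `zero`
      -- covers the rest of its group and `nothing`, and the other cycles follow the pairs of the
      -- frame, with the coordinate `x` of the point as shift.
      tour : Point → Fin s → ℕ → Point
      tour nothing               c       r = embed c (K.tour nothing zero r)
      tour (just ((p , ε) , x))  zero    r = embed p (K.tour (just (ε , x)) zero r)
      tour (just (i , x))        (suc c) r = weave (proj₁ (pairs i c)) (proj₂ (pairs i c)) x 0 r

      hue : Point → Fin s → ℕ → Bool
      hue nothing        c       r = K.hue nothing zero r
      hue (just (i , x)) zero    r = K.hue (just (proj₂ i , x)) zero r
      hue (just (i , x)) (suc c) r = parity r

      closed : ∀ i c → tour i c (h ℕ.* 2) ≡ tour i c 0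
      closed nothing              c       = cong (embed c) (K.closed nothing zero)
      closed (just ((p , ε) , x)) zero    = cong (embed p) (K.closed (just (ε , x)) zero)
      closed (just (i , x))       (suc c) = weave-closed (proj₁ (pairs i c)) (proj₂ (pairs i c)) x

      visits-within : ∀ j p v → v ≢ j →
        ∃[ r ] (r < h ℕ.* 2 × embed p (K.tour j zero r) ≡ embed p v)
      visits-within j p v v≢j with K.visits j v v≢j
      ... | zero , r , r< , e = r , r< , cong (embed p) e

      visits : ∀ i v → v ≢ i → ∃[ c ] ∃[ r ] (r < h ℕ.* 2 × tour i c r ≡ v)
      visits nothing nothing v≢i = contradiction refl v≢i
      visits nothing (just ((p , ε) , x)) v≢i = p , visits-within nothing p (just (ε , x)) λ ()
      visits (just ((p , ε) , x)) nothing v≢i = zero , visits-within (just (ε , x)) p nothing λ ()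
      visits (just (i@(p , ε) , x)) (just (b@(p′ , ε′) , y)) v≢i with p′ F.≟ p
      ... | yes refl = zero , visits-within (just (ε , x)) p (just (ε′ , y)) λ { refl → v≢i refl }
      ... | no p′≢p with matched i b p′≢p
      ...   | c , inj₁ refl = suc c , toℕ y ℕ.* 2 , even< (Fₚ.toℕ<n y) , weave-left (proj₁ (pairs i c)) (proj₂ (pairs i c)) x y
      ...   | c , inj₂ refl = let k , k<h , e = weave-right (proj₁ (pairs i c)) (proj₂ (pairs i c)) x y
                              in suc c , suc (k ℕ.* 2) , odd< k<h , e

      Joined : Bool → Point → Point → Set
      Joined t v w = ∃[ i ] ∃[ c ] ∃[ r ] (r < h ℕ.* 2 × hue i c r ≡ t × Joins (tour i c r) (tour i c (suc r)) v w)

      Joins-map : ∀ {A B : Set} (f : A → B) {a b v w} → Joins a b v w → Joins (f a) (f b) (f v) (f w)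
      Joins-map f (inj₁ (p , q)) = inj₁ (cong f p , cong f q)
      Joins-map f (inj₂ (p , q)) = inj₂ (cong f p , cong f q)

      joined-within : ∀ t p v w → v ≢ w → Joined t (embed p v) (embed p w)
      joined-within t p v w v≢w with K.joined t v w v≢w
      ... | nothing      , zero , r , r< , cl , j = nothing , p , r , r< , cl , Joins-map (embed p) j
      ... | just (ε , x) , zero , r , r< , cl , j = just ((p , ε) , x) , zero , r , r< , cl , Joins-map (embed p) j

      Joins-swap : ∀ {A : Set} {a b v w : A} → Joins a b v w → Joins a b w v
      Joins-swap (inj₁ p) = inj₂ p
      Joins-swap (inj₂ p) = inj₁ p

      -- Edges at `nothing` or inside a group come from `K`. Between groups, `paired` finds the
      -- block `i` and `weave-arc` the point of it whose cycle has the edge in colour `t`.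
      joined : ∀ t v w → v ≢ w → Joined t v w
      joined t nothing nothing v≢w = contradiction refl v≢w
      joined t nothing (just ((p , ε) , x)) v≢w = joined-within t p nothing (just (ε , x)) λ ()
      joined t (just ((p , ε) , x)) nothing v≢w = joined-within t p (just (ε , x)) nothing λ ()
      joined t (just (b@(p , ε) , y)) (just (b′@(p′ , ε′) , y′)) v≢w with p F.≟ p′
      ... | yes refl = joined-within t p (just (ε , y)) (just (ε′ , y′)) λ { refl → v≢w refl }
      ... | no p≢p′ with paired b b′ p≢p′
      ...   | i , c , inj₁ (refl , refl) =
              let x , r , r< , cl , j = weave-arc t (proj₁ (pairs i c)) (proj₂ (pairs i c)) y y′
              in just (i , x) , suc c , r , r< , cl , j
      ...   | i , c , inj₂ (refl , refl) =
              let x , r , r< , cl , j = weave-arc t (proj₁ (pairs i c)) (proj₂ (pairs i c)) y′ y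
              in just (i , x) , suc c , r , r< , cl , Joins-swap j

    blowUp : NearSystem (h ℕ.* 2) s Point
    blowUp = record { tour = tour ; hue = hue ; closed = closed ; visits = visits ; joined = joined }

  -- Frames over cyclic groups of odd order.

  xor-undo : ∀ a b → (a xor b) xor b ≡ a
  xor-undo false false = refl
  xor-undo false true  = refl
  xor-undo true  false = refl
  xor-undo true  true  = refl

  xor-undoˡ : ∀ a b → a xor (a xor b) ≡ b
  xor-undoˡ false b     = refl
  xor-undoˡ true  false = refl
  xor-undoˡ true  true  = refl

  not-xor-undo : ∀ a b → not (a xor b) xor b ≡ not a
  not-xor-undo false false = refl
  not-xor-undo false true  = refl
  not-xor-undo true  false = refl
  not-xor-undo true  true  = refl

  same-or-not : ∀ a b → a ≡ b ⊎ a ≡ not b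
  same-or-not false false = inj₁ refl
  same-or-not false true  = inj₂ refl
  same-or-not true  false = inj₂ refl
  same-or-not true  true  = inj₁ refl

  module Halving (f : ℕ) where
    open Symmetric f public

    private
      -- 1 + f is the inverse of 2 modulo 2f + 1.
      half : ℤ → ℤ
      half z = z * (1ℤ + + f)

      double-half : ∀ z → half z + half z ≈ z
      double-half z = z , lem z (+ f)
        where lem : ∀ z f → z * (1ℤ + f) + z * (1ℤ + f) ≡ z + z * (1ℤ + (f + f))
              lem = solve-∀

    -- Half of the difference is ±d with d at most `f`; the sign decides which of the two residues
    -- is ahead.
    twice : ∀ {x y : Fin (suc (f ℕ.+ f))} → x ≢ y →
      ∃[ d ] (1 ≤ d × d ≤ f × (ι x ≈ ι y + (+ d + + d) ⊎ ι y ≈ ι x + (+ d + + d)))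
    twice {x} {y} x≢y with absolute (half (ι x - ι y)) (λ p → x≢y (ι-injective
        (≈-trans (≡⇒≈ (sym (cancel (ι y) (ι x)))) (≈-trans (+-cong (≈-refl {ι y})
          (≈-trans (≈-sym (double-half (ι x - ι y))) (+-cong p p))) (≡⇒≈ (ℤₚ.+-identityʳ (ι y)))))))
    ... | d , 1≤d , d≤f , inj₁ p = d , 1≤d , d≤f , inj₁ (≈-trans (≡⇒≈ (sym (cancel (ι y) (ι x))))
          (+-cong (≈-refl {ι y}) (≈-trans (≈-sym (double-half (ι x - ι y))) (+-cong p p))))
    ... | d , 1≤d , d≤f , inj₂ p = d , 1≤d , d≤f , inj₂ (≈-trans (≡⇒≈ (lem (ι x) (ι y)))
          (+-cong (≈-refl {ι x}) (≈-trans (neg-cong (≈-trans (≈-sym (double-half (ι x - ι y))) (+-cong p p))) (≡⇒≈ (lem′ (+ d))))))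
      where lem : ∀ x y → y ≡ x + - (x - y)
            lem = solve-∀
            lem′ : ∀ d → - (- d + - d) ≡ d + d
            lem′ = solve-∀

    apart : ∀ {x y : Fin (suc (f ℕ.+ f))} → x ≢ y → ∃[ d ] (d < f × (x ≡ res (ι y + + suc d) ⊎ x ≡ res (ι y - + suc d)))
    apart {x} {y} x≢y with absolute (ι x - ι y) (λ p → x≢y (ι-injective
        (≈-trans (≡⇒≈ (sym (cancel (ι y) (ι x)))) (≈-trans (+-cong (≈-refl {ι y}) p) (≡⇒≈ (ℤₚ.+-identityʳ (ι y)))))))
    ... | suc d , s≤s _ , d≤f , inj₁ p = d , d≤f , inj₁ (sym (trans (res-cong
          (≈-trans (+-cong (≈-refl {ι y}) (≈-sym p)) (≡⇒≈ (cancel (ι y) (ι x))))) (res-ι x)))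
    ... | suc d , s≤s _ , d≤f , inj₂ p = d , d≤f , inj₂ (sym (trans (res-cong
          (≈-trans (+-cong (≈-refl {ι y}) (≈-sym p)) (≡⇒≈ (cancel (ι y) (ι x))))) (res-ι x)))

    around : ∀ {x y : Fin (suc (f ℕ.+ f))} c d d′ → ι x ≈ c + d → ι y ≈ c - d′ →
      x ≡ res (ι (res c) + d) × y ≡ res (ι (res c) - d′)
    around {x} {y} c d d′ p q =
      sym (trans (res-cong (≈-trans (+-cong (ι-res c) (≈-refl {d})) (≈-sym p))) (res-ι x)) ,
      sym (trans (res-cong (≈-trans (+-cong (ι-res c) (≈-refl { - d′})) (≈-sym q))) (res-ι y))

    -- The centre is y + d′, the true midpoint when d = d′.
    midpoint : ∀ {x y : Fin (suc (f ℕ.+ f))} d d′ → ι x ≈ ι y + (d + d′) →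
      ∃[ a ] (x ≡ res (ι a + d) × y ≡ res (ι a - d′))
    midpoint {x} {y} d d′ p = res (ι y + d′) , around (ι y + d′) d d′
      (≈-trans p (≡⇒≈ (lem (ι y) d d′))) (≡⇒≈ (lem′ (ι y) d′))
      where lem : ∀ y d d′ → y + (d + d′) ≡ y + d′ + d
            lem = solve-∀
            lem′ : ∀ y d → y ≡ y + d - d
            lem′ = solve-∀

  -- The patterned starter ±d with an added bit: around (a, ε), block (a + d, η) is paired with (a -
  -- d, η + ε). Two blocks of different groups recover a as the midpoint of their residues and ε as
  -- the sum of their bits.
  oddFrame : ∀ f → Frame (f ℕ.+ f)
  oddFrame f = record { pairs = λ i c → pair i (splitAt f c) ; matched = matched ; paired = paired }
    where
    open Halving f
    pair : Block (suc (f ℕ.+ f)) → Fin f ⊎ Fin f → Block (suc (f ℕ.+ f)) × Block (suc (f ℕ.+ f))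
    pair (a , ε) (inj₁ t) = (res (ι a + + suc (toℕ t)) , false) , (res (ι a - + suc (toℕ t)) , ε)
    pair (a , ε) (inj₂ t) = (res (ι a + + suc (toℕ t)) , true) , (res (ι a - + suc (toℕ t)) , not ε)

    index : Bool → ∀ {d} → d < f → Fin f ⊎ Fin f
    index false d<f = inj₁ (fromℕ< d<f)
    index true  d<f = inj₂ (fromℕ< d<f)

    pair-index : ∀ a ε η {d} (d<f : d < f) → pair (a , ε) (splitAt f (join f f (index η d<f))) ≡
      ((res (ι a + + suc d) , η) , (res (ι a - + suc d) , η xor ε))
    pair-index a ε η d<f rewrite Fₚ.splitAt-join f f (index η d<f) = lem η
      where lem : ∀ η → pair (a , ε) (index η d<f) ≡ ((res (ι a + + suc _) , η) , (res (ι a - + suc _) , η xor ε))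
            lem false = cong (λ d → (res (ι a + + suc d) , false) , (res (ι a - + suc d) , ε)) (Fₚ.toℕ-fromℕ< d<f)
            lem true  = cong (λ d → (res (ι a + + suc d) , true) , (res (ι a - + suc d) , not ε)) (Fₚ.toℕ-fromℕ< d<f)

    matched : ∀ i b → proj₁ b ≢ proj₁ i →
      ∃[ c ] (proj₁ (pair i (splitAt f c)) ≡ b ⊎ proj₂ (pair i (splitAt f c)) ≡ b)
    matched (a , ε) (β , η) β≢a with apart β≢a
    ... | d , d<f , inj₁ p = join f f (index η d<f) , inj₁ (trans (cong proj₁ (pair-index a ε η d<f)) (cong (_, η) (sym p)))
    ... | d , d<f , inj₂ p = join f f (index (η xor ε) d<f) ,
          inj₂ (trans (cong proj₂ (pair-index a ε (η xor ε) d<f)) (cong₂ _,_ (sym p) (xor-undo η ε)))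

    paired : ∀ b b′ → proj₁ b ≢ proj₁ b′ →
      ∃[ i ] ∃[ c ] Joins (proj₁ (pair i (splitAt f c))) (proj₂ (pair i (splitAt f c))) b b′
    paired (β , η) (β′ , η′) β≢β′ with twice β≢β′
    ... | suc d , s≤s _ , d<f , inj₁ p = let a , x , y = midpoint (+ suc d) (+ suc d) p in
          (a , η xor η′) , join f f (index η d<f) , inj₁
            (trans (cong proj₁ (pair-index a (η xor η′) η d<f)) (cong (_, η) (sym x)) ,
             trans (cong proj₂ (pair-index a (η xor η′) η d<f)) (cong₂ _,_ (sym y) (xor-undoˡ η η′)))
    ... | suc d , s≤s _ , d<f , inj₂ p = let a , x , y = midpoint (+ suc d) (+ suc d) p in
          (a , η′ xor η) , join f f (index η′ d<f) , inj₂
            (trans (cong proj₁ (pair-index a (η′ xor η) η′ d<f)) (cong (_, η′) (sym x)) ,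
             trans (cong proj₂ (pair-index a (η′ xor η) η′ d<f)) (cong₂ _,_ (sym y) (xor-undoˡ η′ η)))

  -- The blocks are ℤ_t × ℤ₂ and two infinite blocks (zero , e), where t = 2f + 1.  Around (a , ε)
  -- the mirror pairs {a + x, a − x} have even differences, the rungs {a + j + 1, a − j} odd ones;
  -- the loose ends of the outermost rungs go to the infinite blocks, and the missing difference 1
  -- makes up the pairs belonging to the infinite blocks themselves.
  evenFrame : ∀ f-1 → Frame (suc (suc f-1 ℕ.+ suc f-1))
  evenFrame f-1 = record { pairs = pairs ; matched = matched ; paired = paired }
    where
    f t : ℕ
    f = suc f-1
    t = suc (f ℕ.+ f)
    open Halving f

    B : Set
    B = Block (suc t)

    at : ℤ → Bool → B
    at z η = suc (res z) , η

    -- Rung `j` runs from a - j to a + j + 1 with unequal bits, except that the left end of rung 0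
    -- and the right end of rung `f` are infinite blocks.
    left right : Fin t → Bool → ℕ → B
    left a ε zero    = zero , false
    left a ε (suc j) = at (ι a - + suc j) (not ε xor parity (suc j))
    right a ε j with j ℕ.≟ f
    ... | yes _ = zero , true
    ... | no  _ = at (ι a + + suc j) (ε xor parity j)

    right-last : ∀ a ε → right a ε f ≡ (zero , true)
    right-last a ε with f ℕ.≟ f
    ... | yes _ = refl
    ... | no ¬p = contradiction refl ¬p

    right-inner : ∀ a ε {j} → j < f → right a ε j ≡ at (ι a + + suc j) (ε xor parity j)
    right-inner a ε {j} j<f with j ℕ.≟ f
    ... | yes refl = contradiction j<f (ℕₚ.n≮n f)
    ... | no _ = refl

    pair : Fin t → Bool → Fin (suc f) ⊎ Fin f → B × B
    pair a ε (inj₁ j) = left a ε (toℕ j) , right a ε (toℕ j)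
    pair a ε (inj₂ x) = at (ι a + + suc (toℕ x)) (ε xor parity (suc (toℕ x))) , at (ι a - + suc (toℕ x)) (ε xor parity (suc (toℕ x)))

    pairs : B → Fin t → B × B
    pairs (zero  , e) a = (suc a , e) , at (ι a + 1ℤ) (not e)
    pairs (suc a , ε) c = pair a ε (splitAt (suc f) c)

    rung : ∀ {j} → j ≤ f → Fin t
    rung j≤f = join (suc f) f (inj₁ (fromℕ< (s≤s j≤f)))

    mirror : ∀ {x} → x < f → Fin t
    mirror x<f = join (suc f) f (inj₂ (fromℕ< x<f))

    pairs-rung : ∀ a ε {j} (j≤f : j ≤ f) → pairs (suc a , ε) (rung j≤f) ≡ (left a ε j , right a ε j)
    pairs-rung a ε j≤f rewrite Fₚ.splitAt-join (suc f) f (inj₁ (fromℕ< (s≤s j≤f))) =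
      cong (λ j → left a ε j , right a ε j) (Fₚ.toℕ-fromℕ< (s≤s j≤f))

    pairs-mirror : ∀ a ε {x} (x<f : x < f) → pairs (suc a , ε) (mirror x<f) ≡
      (at (ι a + + suc x) (ε xor parity (suc x)) , at (ι a - + suc x) (ε xor parity (suc x)))
    pairs-mirror a ε x<f rewrite Fₚ.splitAt-join (suc f) f (inj₂ (fromℕ< x<f)) =
      cong (λ x → at (ι a + + suc x) (ε xor parity (suc x)) , at (ι a - + suc x) (ε xor parity (suc x))) (Fₚ.toℕ-fromℕ< x<f)

    Matched : B → B → Set
    Matched i b = ∃[ c ] (proj₁ (pairs i c) ≡ b ⊎ proj₂ (pairs i c) ≡ b)

    by-left : ∀ {i b x y} c → pairs i c ≡ (x , y) → x ≡ b → Matched i b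
    by-left c p q = c , inj₁ (trans (cong proj₁ p) q)

    by-right : ∀ {i b x y} c → pairs i c ≡ (x , y) → y ≡ b → Matched i b
    by-right c p q = c , inj₂ (trans (cong proj₂ p) q)

    not-parity : ∀ {η} ε x → η ≡ not (ε xor parity (suc x)) → ε xor parity x ≡ η
    not-parity false x refl = lem (parity x)
      where lem : ∀ b → b ≡ not (not b)
            lem false = refl
            lem true  = refl
    not-parity true x refl = lem (parity x)
      where lem : ∀ b → not b ≡ not (not (not b))
            lem false = refl
            lem true  = refl

    not-xor : ∀ {η} a b → η ≡ not (a xor b) → not a xor b ≡ η
    not-xor false b     refl = refl
    not-xor true  false refl = refl
    not-xor true  true  refl = refl

    -- Over a ± x the mirror pair takes the bit ε + parity x, and the rung ending there takes the
    -- other bit.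
    matched : ∀ i b → proj₁ b ≢ proj₁ i → Matched i b
    matched (zero , e)  (zero , η)      ne = contradiction refl ne
    matched (zero , e)  (suc β , η)     ne with same-or-not η e
    ... | inj₁ refl = β , inj₁ refl
    ... | inj₂ refl = res (ι β - 1ℤ) , inj₂ (cong (λ x → suc x , not e)
          (trans (res-cong (≈-trans (+-cong (ι-res (ι β - 1ℤ)) (≈-refl {1ℤ})) (≡⇒≈ (lem (ι β))))) (res-ι β)))
          where lem : ∀ b → b - 1ℤ + 1ℤ ≡ b
                lem = solve-∀
    matched (suc a , ε) (zero , false)  ne = by-left {suc a , ε} (rung z≤n) (pairs-rung a ε z≤n) refl
    matched (suc a , ε) (zero , true)   ne = by-right (rung ℕₚ.≤-refl) (pairs-rung a ε ℕₚ.≤-refl) (right-last a ε)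
    matched (suc a , ε) (suc β , η)     ne with apart {β} {a} (ne ∘ cong suc)
    ... | x , x<f , inj₁ p with same-or-not η (ε xor parity (suc x))
    ...   | inj₁ refl = by-left (mirror x<f) (pairs-mirror a ε x<f) (cong (λ y → suc y , η) (sym p))
    ...   | inj₂ q = by-right (rung (ℕₚ.<⇒≤ x<f)) (pairs-rung a ε (ℕₚ.<⇒≤ x<f))
            (trans (right-inner a ε x<f) (cong₂ (λ y η → suc y , η) (sym p) (not-parity ε x q)))
    matched (suc a , ε) (suc β , η)     ne | x , x<f , inj₂ p with same-or-not η (ε xor parity (suc x))
    ...   | inj₁ refl = by-right (mirror x<f) (pairs-mirror a ε x<f) (cong (λ y → suc y , η) (sym p))
    ...   | inj₂ q = by-left (rung x<f) (pairs-rung a ε x<f)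
            (cong₂ (λ y η → suc y , η) (sym p) (not-xor ε (parity (suc x)) q))

    Paired : B → B → Set
    Paired b b′ = ∃[ i ] ∃[ c ] Joins (proj₁ (pairs i c)) (proj₂ (pairs i c)) b b′

    by-pair : ∀ {b b′} i c → pairs i c ≡ (b , b′) → Paired b b′
    by-pair i c p = i , c , inj₁ (cong proj₁ p , cong proj₂ p)

    swap : ∀ {b b′} → Paired b b′ → Paired b′ b
    swap (i , c , inj₁ p) = i , c , inj₂ p
    swap (i , c , inj₂ p) = i , c , inj₁ p

    -- Rung 0 around β - 1 has its right end over β, rung `f` around β + f its left end; the bit of
    -- the centre is chosen to fit.
    infinite : ∀ e β η → Paired (zero , e) (suc β , η)
    infinite false β η = by-pair (suc a , η) (rung z≤n) (trans (pairs-rung a η z≤n)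
      (cong ((zero , false) ,_) (trans (right-inner a η (s≤s z≤n)) (cong₂ (λ y η → suc y , η)
        (trans (res-cong (≈-trans (+-cong (ι-res (ι β - 1ℤ)) (≈-refl {1ℤ})) (≡⇒≈ (lem (ι β))))) (res-ι β)) (Bₚ.xor-identityʳ η)))))
      where
      a = res (ι β - 1ℤ)
      lem : ∀ b → b - 1ℤ + 1ℤ ≡ b
      lem = solve-∀
    infinite true β η = swap (by-pair (suc a , not (η xor parity f)) (rung ℕₚ.≤-refl) (trans (pairs-rung a _ ℕₚ.≤-refl)
      (cong₂ _,_ (cong₂ (λ y η → suc y , η)
        (trans (res-cong (≈-trans (+-cong (ι-res (ι β + + f)) (≈-refl { - + f})) (≡⇒≈ (lem (ι β) (+ f))))) (res-ι β)) (lem′ η (parity f)))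
        (right-last a _))))
      where
      a = res (ι β + + f)
      lem : ∀ b f → b + f - f ≡ b
      lem = solve-∀
      lem′ : ∀ η b → not (not (η xor b)) xor b ≡ η
      lem′ false false = refl
      lem′ false true  = refl
      lem′ true  false = refl
      lem′ true  true  = refl

    alike : ∀ {β β′} η {d} → d < f → ι β ≈ ι β′ + (+ suc d + + suc d) → Paired (suc β , η) (suc β′ , η)
    alike η {d} d<f p = let a , x , y = midpoint (+ suc d) (+ suc d) p in
      by-pair (suc a , η xor parity (suc d)) (mirror d<f) (trans (pairs-mirror a _ d<f)
        (cong₂ _,_ (cong₂ (λ y η → suc y , η) (sym x) (xor-undo η _)) (cong₂ (λ y η → suc y , η) (sym y) (xor-undo η _))))

    -- Difference 1 occurs in the pairs of the infinite blocks, difference 2j + 1 with j > 0 on rung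
    -- `j` around the point that splits it into j + 1 and j.
    unlike : ∀ {β β′} η j → j < f → ι β ≈ ι β′ + (+ suc j + + j) → Paired (suc β , η) (suc β′ , not η)
    unlike {β} {β′} η zero j<f p = swap (by-pair (zero , not η) β′ (cong ((suc β′ , not η) ,_)
      (cong₂ (λ y η → suc y , η) (trans (sym (res-cong p)) (res-ι β)) (Bₚ.not-involutive η))))

    unlike η j@(suc _) j<f p = let a , x , y = midpoint (+ suc j) (+ j) p in
      swap (by-pair (suc a , η xor parity j) (rung (ℕₚ.<⇒≤ j<f)) (trans (pairs-rung a _ (ℕₚ.<⇒≤ j<f))
        (cong₂ _,_ (cong₂ (λ y η → suc y , η) (sym y) (not-xor-undo η (parity j)))
          (trans (right-inner a _ j<f) (cong₂ (λ y η → suc y , η) (sym x) (xor-undo η (parity j)))))))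

    -- 2d = (f + f + 1) − (2j + 1) with j = f − d.
    reversed : ∀ {β β′ : Fin t} {d} → d < f → ι β ≈ ι β′ + (+ suc d + + suc d) →
      ∃[ j ] (j < f × ι β′ ≈ ι β + (+ suc j + + j))
    reversed {β} {β′} {d} d<f p = j , subst (j <_) j+d (ℕₚ.m<m+n j (s≤s z≤n)) ,
      ≈-sym (≈-trans (+-cong p (≈-refl {+ suc j + + j})) (1ℤ , trans (lem (ι β′) (+ suc d) (+ j)) (cong (λ f → ι β′ + 1ℤ * (1ℤ + (+ f + + f))) j+d)))
      where
      j : ℕ
      j = f ∸ suc d
      j+d : j ℕ.+ suc d ≡ f
      j+d = ℕₚ.m∸n+n≡m d<f
      lem : ∀ b d j → b + (d + d) + (1ℤ + j + j) ≡ b + 1ℤ * (1ℤ + ((j + d) + (j + d)))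
      lem = solve-∀

    paired : ∀ b b′ → proj₁ b ≢ proj₁ b′ → Paired b b′
    paired (zero , e)  (zero , e′)   ne = contradiction refl ne
    paired (zero , e)  (suc β , η)   ne = infinite e β η
    paired (suc β , η) (zero , e)    ne = swap (infinite e β η)
    paired (suc β , η) (suc β′ , η′) ne with twice {β} {β′} (ne ∘ cong suc) | same-or-not η′ η
    ... | suc d , s≤s _ , d<f , inj₁ p | inj₁ refl = alike η d<f p
    ... | suc d , s≤s _ , d<f , inj₂ p | inj₁ refl = swap (alike η d<f p)
    -- For unequal bits the even difference 2d is read backwards as an odd one, which `unlike`
    -- handles.
    ... | suc d , s≤s _ , d<f , inj₂ p | inj₂ refl =
          let j , j<f , q = reversed {β′} {β} d<f p in unlike η j j<f q
    ... | suc d , s≤s _ , d<f , inj₁ p | inj₂ refl =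
          let j , j<f , q = reversed {β} {β′} d<f p in swap (subst (λ η″ → Paired (suc β′ , not η) (suc β , η″)) (Bₚ.not-involutive η) (unlike (not η) j j<f q))

open import Data.Nat using (ℕ; _+_; _*_; _∸_; _≤_; _<_)
open import Data.Nat.Divisibility using (_∣_)
open import Data.Nat.Primality using (Prime)
open import Data.List using (List; length; take; drop)
open import Data.Nat.ListAction using (product)
open import Data.List.Relation.Unary.All using (All)
open import Data.List.Relation.Unary.Any using (Any)
open import Relation.Binary.PropositionalEquality using (_≡_)
open import Relation.Nullary using (¬_)

-- Assembling the base systems and the final arithmetic.

Maybe-finite : ∀ {a} {A : Set} → Fin a ↔ A → Fin (suc a) ↔ Maybe A
Maybe-finite I = mk↔ₛ′
  (λ { zero → nothing ; (suc x) → just (to x) })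
  (λ { nothing → zero ; (just y) → suc (from y) })
  (λ { nothing → refl ; (just y) → cong just (strictlyInverseˡ y) })
  (λ { zero → refl ; (suc x) → cong suc (strictlyInverseʳ x) })
  where open Inverse I

h+h≡h*2 : ∀ h → h + h ≡ h * 2
h+h≡h*2 = ℕˢ.solve-∀

-- The case s = 1, relabelled so that one vertex is `nothing` and the others form two blocks of size
-- h.
group : ∀ h-1 → NearSystem (suc h-1 * 2) 1 (Maybe (Bool × Fin (suc h-1)))
group h-1 = subst (λ m → NearSystem m 1 (Maybe (Bool × Fin h))) (h+h≡h*2 h)
  (transport (Maybe-finite (subst (λ n → Fin n ↔ (Bool × Fin h)) (lem h) (×-finite Fₚ.2↔Bool (↔-id (Fin h))))) (oneCycle h-1))
  where
  h : ℕ
  h = suc h-1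
  lem : ∀ h → 2 * h ≡ h + h
  lem = ℕˢ.solve-∀

framed : ∀ {s-1} h-1 → Frame s-1 → NearSystem (suc h-1 * 2) (suc s-1) (Fin (suc (suc s-1 * (suc h-1 * 2))))
framed {s-1} h-1 F = transport (↔-sym (Maybe-finite (subst (λ n → Fin n ↔ (Block (suc s-1) × Fin (suc h-1))) (lem (suc s-1) (suc h-1))
    (×-finite (×-finite (↔-id (Fin (suc s-1))) Fₚ.2↔Bool) (↔-id (Fin (suc h-1)))))))
  (BlowUp.blowUp F (group h-1))
  where lem : ∀ s h → (s * 2) * h ≡ s * (h * 2)
        lem = ℕˢ.solve-∀

-- Odd s, including the one-group frame for s = 1, is served by `oddFrame` and even s from 4 on by
-- `evenFrame`. For s = 2 the blocks outside a group all lie in the other one, so there is no frame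
-- and `twoCycles` steps in.
nearSystem : ∀ h-1 s-1 → NearSystem (suc h-1 * 2) (suc s-1) (Fin (suc (suc s-1 * (suc h-1 * 2))))
nearSystem h-1 s-1 with halve s-1
... | a , inj₁ e = framed h-1 (subst Frame (trans (h+h≡h*2 a) (sym e)) (oddFrame a))
... | suc a , inj₂ e = framed h-1 (subst Frame (trans (cong suc (h+h≡h*2 (suc a))) (sym e)) (evenFrame a))
... | zero , inj₂ refl = subst₂ (λ m n → NearSystem m 2 (Fin (suc n))) (h+h≡h*2 h) (lem h) (twoCycles h-1)
  where
  h : ℕ
  h = suc h-1
  lem : ∀ h → (h + h) + (h + h) ≡ 2 * (h * 2)
  lem = ℕˢ.solve-∀

evef≥1 : ∀ h-1 → Evef≥1 (suc h-1 * 2)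
evef≥1 zero      = two
evef≥1 (suc h-1) = 2+ (evef≥1 h-1)

arcs-exist : ∀ h-1 s f g → 1 ≤ f → suc (f * 2) ∣ g → 1 ≤ g → ARCS (suc (f * 2) * (suc h-1 * 2)) (suc (s * (suc h-1 * 2))) g 2
-- For u = 1 the graph has no edges and the empty family serves.
arcs-exist h-1 zero    f g 1≤f n∣g 1≤g = record
  { nfac = 0 ; factor = λ () ; partition = λ { (zero , _) (zero , _) (ne , _) → contradiction refl ne } }
arcs-exist h-1 (suc s-1) f (suc g-1) 1≤f (divides zero ()) 1≤g
arcs-exist h-1 (suc s-1) f (suc g-1) 1≤f (divides w@(suc _) e) 1≤g =
  Lift.lifted (suc h-1 * 2) (suc s-1) f w g-1 (evef≥1 h-1) 1≤f (trans (ℕₚ.*-comm (suc (f * 2)) w) (sym e)) (nearSystem h-1 s-1)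

odd-product : ∀ {ps} → All (λ p → ¬ (2 ∣ p)) ps → ¬ (2 ∣ product ps)
odd-product [] 2∣1 = contradiction (∣⇒≤ 2∣1) λ { (s≤s ()) }
odd-product {p ∷ ps} (¬2∣p ∷ odd) 2∣ = [ ¬2∣p , odd-product odd ]′ (euclidsLemma p (product ps) prime[2] 2∣)

product≢1 : ∀ {ps} → All Prime ps → 1 ≤ length ps → product ps ≢ 1
product≢1 {p ∷ ps} (pr ∷ _) _ e = ℕ.nonTrivial⇒≢1 {{prime⇒nonTrivial pr}} (ℕₚ.m*n≡1⇒m≡1 p (product ps) e)

theorem4p6 : (k u g i : ℕ) (ps : List ℕ) →
    1 ≤ u → 1 ≤ g →
    All Prime ps → k ≡ product ps → 6 ≤ k → 2 ∣ k →
    1 ≤ i → i < length ps ∸ 1 →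
    Any (λ p → p ≡ 2) (take i ps) →
    All (λ p → ¬ (2 ∣ p)) (drop i ps) →
    product (take i ps) ∣ u ∸ 1 →
    2 * product (drop i ps) ∣ g →
    ARCS k u g 2
theorem4p6 k (suc u-1) g i ps 1≤u 1≤g primes k≡ 6≤k 2∣k 1≤i i<t-1 two∈ odd (divides s u-1≡) 2n∣g
  -- The product n of the last primes is written as 2f + 1; the prime 2 among the first i makes
  -- their product m even.
  with halve (product (drop i ps)) | ∈⇒∣product (Any.map sym two∈)
... | f , inj₁ n≡ | _ = contradiction (divides f n≡) (odd-product odd)
-- n = 1 is impossible, since i < t - 1 leaves a prime in the second part.
... | zero , inj₂ n≡ | _ = contradiction n≡ (product≢1 (drop⁺ i primes)
      (subst (1 ≤_) (sym (Lₚ.length-drop i ps)) (ℕₚ.m<n⇒0<n∸m (ℕₚ.<-≤-trans i<t-1 (ℕₚ.m∸n≤m _ 1)))))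
-- m = 0 would give k = 0.
... | suc f-1 , inj₂ n≡ | divides zero m≡ =
      contradiction (subst (6 ≤_) (trans k≡mn (cong (_* product (drop i ps)) m≡)) 6≤k) λ ()
  where
  k≡mn : k ≡ product (take i ps) * product (drop i ps)
  k≡mn = trans k≡ (trans (cong product (sym (Lₚ.take++drop≡id i ps))) (product-++ (take i ps) (drop i ps)))
... | suc f-1 , inj₂ n≡ | divides (suc h-1) m≡ =
      subst₂ (λ k u → ARCS k (suc u) g 2) (sym k≡nm) (sym (trans u-1≡ (cong (s *_) m≡)))
        (arcs-exist h-1 s (suc f-1) g (s≤s z≤n) (∣-trans (subst (_∣ 2 * product (drop i ps)) n≡ (n∣m*n 2)) 2n∣g) 1≤g)
  where
  k≡nm : k ≡ suc (suc f-1 * 2) * (suc h-1 * 2)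
  k≡nm = trans k≡ (trans (cong product (sym (Lₚ.take++drop≡id i ps))) (trans (product-++ (take i ps) (drop i ps))
    (trans (cong₂ _*_ m≡ n≡) (ℕₚ.*-comm (suc h-1 * 2) (suc (suc f-1 * 2))))))
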